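{- For every integer $n\ge1$, $spt_o^{ - }(2n)\equiv 0\pmod 2$.
   Context: For a nonempty integer partition $\pi$, let $s(\pi)$ be its smallest part, and call $\pi$ admissible if no odd part of $\pi$ is greater than $2s(\pi)$. For $l\ge1$ let $\delta_l=(l-1,l-2,\dots,1)$, a partition of size $\binom{l}{2}$. $spt_o^{ - }(m)$ is the total number of occurrences of $s(\pi)$ in $\pi$, summed over all pairs $(\pi,\delta_{s(\pi)})$ with $\pi$ admissible and $|\pi|+\binom{s(\pi)}{2}=m$; equivalently $\sum_{m\ge1}spt_o^{ - }(m)q^m=\sum_{n\ge1}\frac{q^{n(n+1)/2}(q^{2n+1};q^2)_\infty}{(1-q^n)^2(q^{n+1};q)_\infty}$, where $(a;q)_\infty=\prod_{k\ge0}(1-aq^k)$. -}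

module Defs where

open import Data.Nat using (ℕ; zero; suc; _+_; _*_; _∸_; _≡ᵇ_; _≤ᵇ_; _%_)
open import Data.Nat.Combinatorics using (_C_)
open import Data.Bool using (Bool; true; false; if_then_else_; _∧_; _∨_; not)
open import Data.List using (List; []; _∷_; [_]; map; concatMap; upTo; filter; length; all)
open import Data.Nat.ListAction using (sum)
open import Relation.Nullary.Decidable using (does)
open import Data.Nat using (_≟_)

-- Integer partitions are represented as lists of positive parts in
-- weakly INCREASING order (so the head is the smallest part).

-- ptns fuel n k : all partitions of n (increasing lists) with every part ≥ k.
-- Requires k ≥ 1; fuel ≥ n suffices (each step removes a part ≥ 1).
ptns : ℕ → ℕ → ℕ → List (List ℕ)
ptns _       zero    _ = [ [] ]
ptns zero    (suc n) _ = []
ptns (suc f) (suc n) k =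
  concatMap (λ p → map (p ∷_) (ptns f (suc n ∸ p) p))
            (map (k +_) (upTo (suc (suc n) ∸ k)))

partitions : ℕ → List (List ℕ)
partitions n = ptns n n 1

-- smallest part of a partition (0 for the empty partition, never used)
smallest : List ℕ → ℕ
smallest []      = 0
smallest (p ∷ _) = p

odd? : ℕ → Bool
odd? p = p % 2 ≡ᵇ 1

admissible : List ℕ → Bool
admissible π = all (λ p → not (odd? p) ∨ (p ≤ᵇ 2 * smallest π)) π

occ : ℕ → List ℕ → ℕ
occ x π = length (filter (λ p → x ≟ p) π)

contrib : ℕ → ℕ → List ℕ → ℕ
contrib m N []        = 0
contrib m N π@(s ∷ _) =
  if admissible π ∧ (N + s C 2 ≡ᵇ m) then occ s π else 0

-- spt_o^-(m): sum over all nonempty admissible π with |π| + binom(s(π),2) = m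
-- (pairs (π, δ_{s(π)}), δ being determined by π) of the multiplicity of s(π).
-- Since |π| ≤ m, it suffices to range over sizes N = 1..m.
spto⁻ : ℕ → ℕ
spto⁻ m = sum (map (λ i → let N = suc i in
                     sum (map (contrib m N) (partitions N)))
                   (upTo m))

{-# OPTIONS --safe #-}

-- Everything happens in 𝔽₂[[q]]. Modulo 2 we have (q²;q²)_n = (q)_n², and multiplying the generating
-- function by (q²;q²)_∞ turns its n-th summand into qⁿ (q)_{n-1}² βₙ, βₙ = q^{n(n-1)/2} (q)ₙ / (q)_{2n}.
-- Now βₙ is half of a Bailey pair relative to 1, namely βₙ = Σᵣ αᵣ / ((q)_{n-r} (q)_{n+r}) with α₀ = 1,
-- α_{2t} = q^{t²-t} (1 + q^{2t}) and αᵣ = 0 for odd r. Exchanging the two sums, the sum over n telescopes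
-- for each r and leaves the Lambert series Σₙ qⁿ (1 + q^{n²}) / (1 - q^{2n}). Its even part vanishes:
-- both Σ qⁿ / (1 - q^{2n}) and Σ q^{n²+n} / (1 - q^{2n}) count the factorisations of an even number into
-- an even and an odd factor. Dividing by the even series (q²;q²)_∞ preserves this.
-- Infinite products and sums are truncated, with errors of order higher than the coefficient in question.

module Submission where

open import Defs
open import Data.Nat using (ℕ; zero; suc; _+_; _*_; _∸_; _≤_; _<_; z≤n; s≤s; _≡ᵇ_; _≤ᵇ_; _≟_)
open import Data.Nat.Divisibility using (_∣_; ∣m∣n⇒∣m+n; ∣-refl; _∣0)
open import Data.Nat.Combinatorics using (_C_; nCk+nC[k+1]≡[n+1]C[k+1]; nC1≡n)
open import Data.Nat.Induction using (<-rec)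
open import Data.Nat.ListAction using (sum)
import Data.Nat.Properties as ℕ
open import Data.Nat.Tactic.RingSolver using (solve-∀)
open import Data.Bool using (Bool; true; false; not; _∧_; _∨_; _xor_; if_then_else_)
open import Data.Bool.ListAction using (all)
open import Data.Bool.Properties
  using (xor-comm; xor-assoc; xor-same; xor-identityʳ; not-distribˡ-xor; not-distribʳ-xor; not-involutive
        ; ∧-comm; ∧-assoc; ∧-zeroʳ; ∨-zeroʳ; ∧-distribˡ-xor; ∧-distribʳ-xor; xor-∧-commutativeRing; T-≡)
open import Data.List using (List; []; _∷_; _++_; map; concatMap; upTo; applyUpTo; length)
open import Data.List.Properties
  using (filter-accept; filter-reject; concatMap-map; concatMap-cong; map-cong; map-∘; map-upTo)
open import Data.Maybe using (Maybe; just; nothing)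
open import Data.Product using (_,_; ∃)
open import Data.Sum using (_⊎_; inj₁; inj₂)
open import Function using (_∘_; id)
open import Function.Bundles using (Equivalence)
open import Relation.Nullary using (contradiction)
open import Relation.Binary.PropositionalEquality
  using (_≡_; _≢_; _≗_; refl; sym; trans; cong; cong₂; subst; module ≡-Reasoning)
open import Relation.Binary.Structures using (IsEquivalence)
open import Algebra.Structures using (IsCommutativeSemiring)
open import Algebra.Bundles using (CommutativeRing; CommutativeSemiring)
import Algebra.Properties.CommutativeSemigroup
import Algebra.Solver.Ring
open import Algebra.Solver.Ring.AlmostCommutativeRing
  using (_-Raw-AlmostCommutative⟶_; fromCommutativeSemiring)

open Algebra.Properties.CommutativeSemigroup
       (CommutativeRing.+-commutativeSemigroup xor-∧-commutativeRing)
  using () renaming (interchange to xor-interchange)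

-- Power series over 𝔽₂

infixl 6 _⊕_ _⊕′_
infixl 7 _⊗_ _⊗′_
infix 4 _≈_

-- Apart from removing signs, characteristic 2 enters through `1 - q^(2k) = (1 - q^k)^2`. This turns
-- the even admissible parts into squares, closes the recurrence for β and makes `1/(1 - q^n)^2` a
-- Lambert denominator. The vanishing of α at odd indices is also special to it: over the integers
-- the same β has α₁ = -2q. The expansion of β does not rest on general Bailey theory: both sides
-- agree at n = 0 and satisfy the same first-order recurrence, whose factors `1 - q^k` can be
-- cancelled. After all exponents are split into a few monomials regarded as independent, each
-- verification is a polynomial identity for the ring solver. For the coefficient of q^(2A),
-- smallest parts run up to 2A and (q²;q²)_∞ is replaced by `Q M ⊗ Q M` with M = 2A. The three
-- errors then have known orders: 2M + 1 from the parts beyond 2M, 2A + 1 from replacing the columns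
-- by their limits, and at least 2A + 2 from the incomplete Lambert sums.

Series : Set
Series = ℕ → Bool

-- A record, so that both series can be inferred from the type of a proof.
record _≈_ (f g : Series) : Set where
  constructor coefficients
  field coefficient : ∀ n → f n ≡ g n
open _≈_

const : Bool → Series
const b zero    = b
const b (suc n) = false

𝟘 𝟙 : Series
𝟘 = const false
𝟙 = const true

_⊕′_ : Series → Series → Series
(f ⊕′ g) n = f n xor g n

_⊗′_ : Series → Series → Series
(f ⊗′ g) zero    = f 0 ∧ g 0
(f ⊗′ g) (suc n) = (f 0 ∧ g (suc n)) xor ((f ∘ suc) ⊗′ g) n

⊗-cong-at : ∀ {f f′ g g′} → (∀ n → f n ≡ f′ n) → (∀ n → g n ≡ g′ n) →
            ∀ n → (f ⊗′ g) n ≡ (f′ ⊗′ g′) n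
⊗-cong-at f≡ g≡ zero    = cong₂ _∧_ (f≡ 0) (g≡ 0)
⊗-cong-at f≡ g≡ (suc n) =
  cong₂ _xor_ (cong₂ _∧_ (f≡ 0) (g≡ (suc n))) (⊗-cong-at (f≡ ∘ suc) g≡ n)

⊗-zeroˡ-at : ∀ f → (∀ n → f n ≡ false) → ∀ g n → (f ⊗′ g) n ≡ false
⊗-zeroˡ-at f f≡0 g zero    rewrite f≡0 0 = refl
⊗-zeroˡ-at f f≡0 g (suc n) rewrite f≡0 0 = ⊗-zeroˡ-at (f ∘ suc) (f≡0 ∘ suc) g n

𝟘-at : ∀ n → 𝟘 n ≡ false
𝟘-at zero    = refl
𝟘-at (suc n) = refl

𝟙-⊗-at : ∀ g n → (𝟙 ⊗′ g) n ≡ g n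
𝟙-⊗-at g zero    = refl
𝟙-⊗-at g (suc n) =
  trans (cong (g (suc n) xor_) (⊗-zeroˡ-at (𝟙 ∘ suc) (λ _ → refl) g n)) (xor-identityʳ _)

⊗-distribʳ-at : ∀ h f g n → ((f ⊕′ g) ⊗′ h) n ≡ (f ⊗′ h) n xor (g ⊗′ h) n
⊗-distribʳ-at h f g zero    = ∧-distribʳ-xor (h 0) (f 0) (g 0)
⊗-distribʳ-at h f g (suc n) =
  trans (cong₂ _xor_ (∧-distribʳ-xor (h (suc n)) (f 0) (g 0))
                     (⊗-distribʳ-at h (f ∘ suc) (g ∘ suc) n))
        (xor-interchange (f 0 ∧ h (suc n)) (g 0 ∧ h (suc n)) _ _)

-- `_⊗′_` recurses on its left factor; this is the mirror recursion on the right factor, from which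
-- commutativity follows by induction on the coefficient.
⊗-suc : ∀ f g n → (f ⊗′ g) (suc n) ≡ (f (suc n) ∧ g 0) xor (f ⊗′ (g ∘ suc)) n
⊗-suc f g zero    = xor-comm (f 0 ∧ g 1) (f 1 ∧ g 0)
⊗-suc f g (suc n) = begin
  a xor ((f ∘ suc) ⊗′ g) (suc n)     ≡⟨ cong (a xor_) (⊗-suc (f ∘ suc) g n) ⟩
  a xor (b xor c)                   ≡⟨ xor-assoc a b c ⟨
  (a xor b) xor c                   ≡⟨ cong (_xor c) (xor-comm a b) ⟩
  (b xor a) xor c                   ≡⟨ xor-assoc b a c ⟩
  b xor (a xor c)                   ∎
  where
  open ≡-Reasoning
  a = f 0 ∧ g (suc (suc n))
  b = f (suc (suc n)) ∧ g 0
  c = ((f ∘ suc) ⊗′ (g ∘ suc)) n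

⊗-comm-at : ∀ f g n → (f ⊗′ g) n ≡ (g ⊗′ f) n
⊗-comm-at f g zero    = ∧-comm (f 0) (g 0)
⊗-comm-at f g (suc n) =
  trans (cong₂ _xor_ (∧-comm (f 0) (g (suc n))) (⊗-comm-at (f ∘ suc) g n)) (sym (⊗-suc g f n))

⊗-scale-at : ∀ b f g n → ((λ i → b ∧ f i) ⊗′ g) n ≡ b ∧ (f ⊗′ g) n
⊗-scale-at false f g n = ⊗-zeroˡ-at _ (λ _ → refl) g n
⊗-scale-at true  f g n = ⊗-cong-at (λ _ → refl) (λ _ → refl) n

⊗-assoc-at : ∀ f g h n → ((f ⊗′ g) ⊗′ h) n ≡ (f ⊗′ (g ⊗′ h)) n
⊗-assoc-at f g h zero    = ∧-assoc (f 0) (g 0) (h 0)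
⊗-assoc-at f g h (suc n) = begin
  -- The tail of `f ⊗′ g` is, by definition, a multiple of the tail of g plus `f′ ⊗′ g`;
  -- distributivity separates the two.
  (a ∧ g 0) ∧ h (suc n) xor (((λ i → a ∧ g (suc i)) ⊕′ (f′ ⊗′ g)) ⊗′ h) n
    ≡⟨ cong₂ _xor_ (∧-assoc a (g 0) (h (suc n)))
         (⊗-distribʳ-at h (λ i → a ∧ g (suc i)) (f′ ⊗′ g) n) ⟩
  (a ∧ (g 0 ∧ h (suc n))) xor (((λ i → a ∧ g (suc i)) ⊗′ h) n xor ((f′ ⊗′ g) ⊗′ h) n)
    ≡⟨ cong ((a ∧ (g 0 ∧ h (suc n))) xor_)
         (cong₂ _xor_ (⊗-scale-at a (g ∘ suc) h n) (⊗-assoc-at f′ g h n)) ⟩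
  (a ∧ (g 0 ∧ h (suc n))) xor ((a ∧ ((g ∘ suc) ⊗′ h) n) xor (f′ ⊗′ (g ⊗′ h)) n)
    ≡⟨ xor-assoc (a ∧ (g 0 ∧ h (suc n))) _ _ ⟨
  ((a ∧ (g 0 ∧ h (suc n))) xor (a ∧ ((g ∘ suc) ⊗′ h) n)) xor (f′ ⊗′ (g ⊗′ h)) n
    ≡⟨ cong (_xor (f′ ⊗′ (g ⊗′ h)) n) (∧-distribˡ-xor a (g 0 ∧ h (suc n)) _) ⟨
  (a ∧ ((g 0 ∧ h (suc n)) xor ((g ∘ suc) ⊗′ h) n)) xor (f′ ⊗′ (g ⊗′ h)) n ∎
  where
  open ≡-Reasoning
  a = f 0
  f′ = f ∘ suc

≈-isEquivalence : IsEquivalence _≈_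
≈-isEquivalence = record
  { refl = coefficients λ _ → refl
  ; sym = λ p → coefficients λ n → sym (coefficient p n)
  ; trans = λ p q → coefficients λ n → trans (coefficient p n) (coefficient q n) }

⊕′-⊗′-isCommutativeSemiring : IsCommutativeSemiring _≈_ _⊕′_ _⊗′_ 𝟘 𝟙
⊕′-⊗′-isCommutativeSemiring = record
  { isSemiring = record
      { isSemiringWithoutAnnihilatingZero = record
        { +-isCommutativeMonoid = record
          { isMonoid = record
            { isSemigroup = record
              { isMagma = record
                { isEquivalence = ≈-isEquivalence
                ; ∙-cong = λ p q → coefficients λ n → cong₂ _xor_ (coefficient p n) (coefficient q n) }
              ; assoc = λ f g h → coefficients λ n → xor-assoc (f n) (g n) (h n) }
            ; identity = (λ f → coefficients λ n → cong (_xor f n) (𝟘-at n))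
                       , (λ f → coefficients λ n → trans (cong (f n xor_) (𝟘-at n)) (xor-identityʳ _)) }
          ; comm = λ f g → coefficients λ n → xor-comm (f n) (g n) }
        ; *-cong = λ p q → coefficients (⊗-cong-at (coefficient p) (coefficient q))
        ; *-assoc = λ f g h → coefficients (⊗-assoc-at f g h)
        ; *-identity = (λ f → coefficients (𝟙-⊗-at f))
                     , (λ f → coefficients λ n → trans (⊗-comm-at f 𝟙 n) (𝟙-⊗-at f n))
        ; distrib = (λ h f g → coefficients λ n →
                       trans (⊗-comm-at h (f ⊕′ g) n)
                      (trans (⊗-distribʳ-at h f g n)
                             (cong₂ _xor_ (⊗-comm-at f h n) (⊗-comm-at g h n))))
                  , (λ h f g → coefficients (⊗-distribʳ-at h f g)) }
      ; zero = (λ f → coefficients λ n → trans (⊗-zeroˡ-at 𝟘 𝟘-at f n) (sym (𝟘-at n)))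
             , (λ f → coefficients λ n →
                  trans (⊗-comm-at f 𝟘 n) (trans (⊗-zeroˡ-at 𝟘 𝟘-at f n) (sym (𝟘-at n)))) }
    ; *-comm = λ f g → coefficients (⊗-comm-at f g) }

-- Opaque, because unification cannot recover f and g from the unfolded coefficients of f ⊕ g and f ⊗ g.
opaque
  _⊕_ _⊗_ : Series → Series → Series
  _⊕_ = _⊕′_
  _⊗_ = _⊗′_

  ⊕-⊗-isCommutativeSemiring : IsCommutativeSemiring _≈_ _⊕_ _⊗_ 𝟘 𝟙
  ⊕-⊗-isCommutativeSemiring = ⊕′-⊗′-isCommutativeSemiring

seriesSemiring : CommutativeSemiring _ _
seriesSemiring = record { isCommutativeSemiring = ⊕-⊗-isCommutativeSemiring }

open CommutativeSemiring seriesSemiring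
  using (setoid)
  renaming ( refl to ≈-refl; sym to ≈-sym; trans to ≈-trans; reflexive to ≈-reflexive
           ; +-cong to ⊕-cong; *-cong to ⊗-cong)
open import Relation.Binary.Reasoning.Setoid setoid
  using (begin_; step-≈-⟩; step-≈-⟨; _∎)

opaque
  unfolding _⊕_ _⊗_

  const-xor : ∀ a b → const (a xor b) ≈ const a ⊕ const b
  const-xor a b = coefficients λ { zero → refl ; (suc n) → refl }

  const-∧ : ∀ a b → const (a ∧ b) ≈ const a ⊗ const b
  const-∧ a b = coefficients λ
    { zero    → refl
    ; (suc n) → sym (cong₂ _xor_ (∧-zeroʳ a) (⊗-zeroˡ-at (const a ∘ suc) (λ _ → refl) (const b) n)) }

-- Coefficients in 𝔽₂ let the ring solver use 1 + 1 = 0.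
constants : CommutativeRing.rawRing xor-∧-commutativeRing
              -Raw-AlmostCommutative⟶ fromCommutativeSemiring seriesSemiring
constants = record
  { ⟦_⟧ = const
  ; +-homo = const-xor
  ; *-homo = const-∧
  ; -‿homo = λ _ → ≈-refl
  ; 0-homo = ≈-refl
  ; 1-homo = ≈-refl
  }

_const≟_ : ∀ a b → Maybe (const a ≈ const b)
false const≟ false = just ≈-refl
true  const≟ true  = just ≈-refl
_     const≟ _     = nothing

open Algebra.Solver.Ring
       (CommutativeRing.rawRing xor-∧-commutativeRing) (fromCommutativeSemiring seriesSemiring) constants _const≟_
  using (solve; _:=_; _:+_; _:*_; con)

⊕-same : ∀ f → f ⊕ f ≈ 𝟘
⊕-same = solve 1 (λ f → f :+ f := con false) ≈-refl

⊕-identityʳ : ∀ f → f ⊕ 𝟘 ≈ f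
⊕-identityʳ = solve 1 (λ f → f :+ con false := f) ≈-refl

⊗-zeroʳ : ∀ f → f ⊗ 𝟘 ≈ 𝟘
⊗-zeroʳ = solve 1 (λ f → f :* con false := con false) ≈-refl

⊕-≈𝟘⇒≈ : ∀ {f g} → f ⊕ g ≈ 𝟘 → f ≈ g
⊕-≈𝟘⇒≈ {f} {g} p = begin
  f             ≈⟨ solve 2 (λ f g → f := (f :+ g) :+ g) ≈-refl f g ⟩
  (f ⊕ g) ⊕ g   ≈⟨ ⊕-cong p ≈-refl ⟩
  𝟘 ⊕ g         ≈⟨ solve 1 (λ g → con false :+ g := g) ≈-refl g ⟩
  g             ∎

-- Monomials, the factors 1 - q^k and their inverses

shift : Series → Series
shift f zero    = false
shift f (suc n) = f n

shift-cong : ∀ {f g} → f ≈ g → shift f ≈ shift g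
shift-cong p = coefficients λ { zero → refl ; (suc n) → coefficient p n }

opaque
  unfolding _⊗_

  shift-⊗ : ∀ f g → shift f ⊗ g ≈ shift (f ⊗ g)
  shift-⊗ f g = coefficients λ { zero → refl ; (suc n) → refl }

opaque
  X : ℕ → Series
  X zero    = 𝟙
  X (suc k) = shift (X k)

  X-0 : X 0 ≈ 𝟙
  X-0 = ≈-refl

  X-suc-⊗ : ∀ k f → X (suc k) ⊗ f ≈ shift (X k ⊗ f)
  X-suc-⊗ k f = shift-⊗ (X k) f

  X-+ : ∀ a b → X (a + b) ≈ X a ⊗ X b
  X-+ zero    b = solve 1 (λ x → x := con true :* x) ≈-refl (X b)
  X-+ (suc a) b = ≈-trans (shift-cong (X-+ a b)) (≈-sym (shift-⊗ (X a) (X b)))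

D : ℕ → Series
D k = 𝟙 ⊕ X k

D-0 : D 0 ≈ 𝟘
D-0 = ≈-trans (⊕-cong ≈-refl X-0) (⊕-same 𝟙)

X-0-⊗ : ∀ f → X 0 ⊗ f ≈ f
X-0-⊗ f = ≈-trans (⊗-cong X-0 ≈-refl) (solve 1 (λ f → con true :* f := f) ≈-refl f)

X-split : ∀ {n} a b → n ≡ a + b → X n ≈ X a ⊗ X b
X-split a b refl = X-+ a b

X-split₃ : ∀ {n} a b c → n ≡ a + (b + c) → X n ≈ X a ⊗ (X b ⊗ X c)
X-split₃ a b c p = ≈-trans (X-split a (b + c) p) (⊗-cong ≈-refl (X-+ b c))

D-double : ∀ k → D (k + k) ≈ D k ⊗ D k
D-double k = begin
  𝟙 ⊕ X (k + k)     ≈⟨ ⊕-cong ≈-refl (X-+ k k) ⟩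
  𝟙 ⊕ X k ⊗ X k     ≈⟨ solve 1 (λ x → con true :+ x :* x
                                   := (con true :+ x) :* (con true :+ x)) ≈-refl (X k) ⟩
  D k ⊗ D k         ∎

-- The series with ones exactly at c, c + (k + 1), c + 2 (k + 1), …
progression : ℕ → ℕ → Series
progression k zero    zero    = true
progression k (suc c) zero    = false
progression k zero    (suc n) = progression k k n
progression k (suc c) (suc n) = progression k c n

opaque
  unfolding _⊕_

  progression-unfold : ∀ k → progression k 0 ≈ 𝟙 ⊕ shift (progression k k)
  progression-unfold k = coefficients λ { zero → refl ; (suc n) → refl }

-- The inverse of `D k`. The value at 0 is a default, because `D 0` is zero.
G : ℕ → Series
G zero    = 𝟘
G (suc k) = progression k 0

progression≈ : ∀ k c → progression k c ≈ X c ⊗ progression k 0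
progression≈ k zero    = ≈-sym (X-0-⊗ _)
progression≈ k (suc c) = begin
  progression k (suc c)              ≈⟨ coefficients (λ { zero → refl ; (suc n) → refl }) ⟩
  shift (progression k c)            ≈⟨ shift-cong (progression≈ k c) ⟩
  shift (X c ⊗ progression k 0)      ≈⟨ X-suc-⊗ c _ ⟨
  X (suc c) ⊗ progression k 0        ∎

D-G : ∀ k → D (suc k) ⊗ G (suc k) ≈ 𝟙
D-G k = begin
  (𝟙 ⊕ X (suc k)) ⊗ g
    ≈⟨ solve 2 (λ x g → (con true :+ x) :* g := g :+ x :* g) ≈-refl (X (suc k)) g ⟩
  g ⊕ X (suc k) ⊗ g
    ≈⟨ ⊕-cong (progression-unfold k) (≈-trans (X-suc-⊗ k g) (shift-cong (≈-sym (progression≈ k k)))) ⟩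
  (𝟙 ⊕ h) ⊕ h                ≈⟨ solve 1 (λ h → (con true :+ h) :+ h := con true) ≈-refl h ⟩
  𝟙                          ∎
  where
  g = G (suc k)
  h = shift (progression k k)
D-cancel : ∀ k {f g} → D (suc k) ⊗ f ≈ D (suc k) ⊗ g → f ≈ g
D-cancel k {f} {g} p = begin
  f                                   ≈⟨ insert f ⟩
  G (suc k) ⊗ (D (suc k) ⊗ f)         ≈⟨ ⊗-cong ≈-refl p ⟩
  G (suc k) ⊗ (D (suc k) ⊗ g)         ≈⟨ insert g ⟨
  g                                   ∎
  where
  insert : ∀ f → f ≈ G (suc k) ⊗ (D (suc k) ⊗ f)
  insert f = begin
    f                                  ≈⟨ solve 1 (λ f → f := con true :* f) ≈-refl f ⟩
    𝟙 ⊗ f                              ≈⟨ ⊗-cong (D-G k) ≈-refl ⟨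
    (D (suc k) ⊗ G (suc k)) ⊗ f
      ≈⟨ solve 3 (λ d g f → (d :* g) :* f := g :* (d :* f)) ≈-refl (D (suc k)) (G (suc k)) f ⟩
    G (suc k) ⊗ (D (suc k) ⊗ f)        ∎

-- The q-factorial (q)_k and its inverse 1/(q)_k.
Q P : ℕ → Series
Q zero    = 𝟙
Q (suc k) = Q k ⊗ D (suc k)
P zero    = 𝟙
P (suc k) = P k ⊗ G (suc k)

P-step : ∀ k → P k ≈ D (suc k) ⊗ P (suc k)
P-step k = begin
  P k                                ≈⟨ solve 1 (λ p → p := p :* con true) ≈-refl (P k) ⟩
  P k ⊗ 𝟙                            ≈⟨ ⊗-cong ≈-refl (D-G k) ⟨
  P k ⊗ (D (suc k) ⊗ G (suc k))
    ≈⟨ solve 3 (λ p d g → p :* (d :* g) := d :* (p :* g)) ≈-refl (P k) (D (suc k)) (G (suc k)) ⟩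
  D (suc k) ⊗ P (suc k)              ∎

Q-P : ∀ k → Q k ⊗ P k ≈ 𝟙
Q-P zero    = solve 0 (con true :* con true := con true) ≈-refl
Q-P (suc k) = begin
  (Q k ⊗ D (suc k)) ⊗ P (suc k)
    ≈⟨ solve 3 (λ q d p → (q :* d) :* p := q :* (d :* p)) ≈-refl (Q k) (D (suc k)) (P (suc k)) ⟩
  Q k ⊗ (D (suc k) ⊗ P (suc k))   ≈⟨ ⊗-cong ≈-refl (P-step k) ⟨
  Q k ⊗ P k                       ≈⟨ Q-P k ⟩
  𝟙                               ∎

-- 1/(q)_{k-1}, with the convention 1/(q)_{-1} = 0.
I : ℕ → Series
I zero    = 𝟘
I (suc k) = P k

-- At k = 0 both sides vanish, since `D 0` is zero. Thus the first index at which a column enters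
-- obeys the same formula as all later ones.
I-step : ∀ k → I k ≈ D k ⊗ P k
I-step zero    = ≈-sym (≈-trans (⊗-cong D-0 ≈-refl) (solve 0 (con false :* con true := con false) ≈-refl))
I-step (suc k) = P-step k

I-∸≈𝟘 : ∀ {m n} → m ≤ n → I (m ∸ n) ≈ 𝟘
I-∸≈𝟘 m≤n = ≈-reflexive (cong I (ℕ.m≤n⇒m∸n≡0 m≤n))

-- Finite sums of series

∑ : ℕ → (ℕ → Series) → Series
∑ zero    f = 𝟘
∑ (suc R) f = ∑ R f ⊕ f R

∑-cong : ∀ R {f g : ℕ → Series} → (∀ t → f t ≈ g t) → ∑ R f ≈ ∑ R g
∑-cong zero    p = ≈-refl
∑-cong (suc R) p = ⊕-cong (∑-cong R p) (p R)

∑-⊕ : ∀ R f g → ∑ R (λ t → f t ⊕ g t) ≈ ∑ R f ⊕ ∑ R g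
∑-⊕ zero    f g = solve 0 (con false := con false :+ con false) ≈-refl
∑-⊕ (suc R) f g = ≈-trans (⊕-cong (∑-⊕ R f g) ≈-refl)
  (solve 4 (λ a b c d → (a :+ b) :+ (c :+ d) := (a :+ c) :+ (b :+ d)) ≈-refl (∑ R f) (∑ R g) (f R) (g R))

∑-⊗ : ∀ R a f → ∑ R (λ t → a ⊗ f t) ≈ a ⊗ ∑ R f
∑-⊗ zero    a f = solve 1 (λ a → con false := a :* con false) ≈-refl a
∑-⊗ (suc R) a f = ≈-trans (⊕-cong (∑-⊗ R a f) ≈-refl)
  (solve 3 (λ a s x → a :* s :+ a :* x := a :* (s :+ x)) ≈-refl a (∑ R f) (f R))

∑-telescope : ∀ R (g : ℕ → Series) → ∑ R (λ t → g t ⊕ g (suc t)) ≈ g 0 ⊕ g R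
∑-telescope zero    g = ≈-sym (⊕-same (g 0))
∑-telescope (suc R) g = ≈-trans (⊕-cong (∑-telescope R g) ≈-refl)
  (solve 3 (λ a b c → (a :+ b) :+ (b :+ c) := a :+ c) ≈-refl (g 0) (g R) (g (suc R)))

∑-𝟘 : ∀ R {f} → (∀ t → f t ≈ 𝟘) → ∑ R f ≈ 𝟘
∑-𝟘 zero    p = ≈-refl
∑-𝟘 (suc R) p = ≈-trans (⊕-cong (∑-𝟘 R p) (p R)) (⊕-same 𝟘)

-- The Bailey pair

-- α_r / ((q)_{n-r} (q)_{n+r}) for r = 2t + 2, and the certificate found by the Wilf-Zeilberger method
-- for the recurrence (1 - q^{n+1}) (1 - q^{2n+1}) β_{n+1} = qⁿ βₙ.
term telescope : ℕ → ℕ → Series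
term n t = X (t * suc t) ⊗ D (2 + (t + t)) ⊗ I (n ∸ suc (t + t)) ⊗ P (n + (2 + (t + t)))
telescope n t = X (t * suc t) ⊗ I (n ∸ (t + t)) ⊗ P (suc n + (t + t))

-- Naming the excess e replaces truncated differences such as `n ∸ (t + t)` by exponents that the
-- monomial rules can split.
offset : ∀ n m → n ≤ m ⊎ ∃ λ e → n ≡ suc m + e
offset n m with ℕ.≤-<-connex n m
... | inj₁ n≤m = inj₁ n≤m
... | inj₂ m<n = inj₂ (n ∸ suc m , sym (ℕ.m+[n∸m]≡n m<n))

vanishing-factor : ∀ a {f} b → f ≈ 𝟘 → a ⊗ f ⊗ b ≈ 𝟘
vanishing-factor a b p = ≈-trans (⊗-cong (⊗-cong ≈-refl p) ≈-refl)
  (solve 2 (λ a b → a :* con false :* b := con false) ≈-refl a b)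

both-𝟘 : ∀ {f g} a b → f ≈ 𝟘 → g ≈ 𝟘 → a ⊗ f ⊕ b ⊗ g ≈ 𝟘
both-𝟘 a b p q = ≈-trans (⊕-cong (⊗-cong ≈-refl p) (⊗-cong ≈-refl q))
  (solve 2 (λ a b → a :* con false :+ b :* con false := con false) ≈-refl a b)

P-step-at : ∀ {m n} → n ≡ suc m → P m ≈ D n ⊗ P n
P-step-at refl = P-step _

P≡ : ∀ {m n} → m ≡ n → P m ≈ P n
P≡ refl = ≈-refl

I≡ : ∀ {m n} → m ≡ n → I m ≈ I n
I≡ refl = ≈-refl

infixl 6 _⟨⊕⟩_
infixl 7 _⟨⊗⟩_

_⟨⊕⟩_ : ∀ {f f′ g g′} → f ≈ f′ → g ≈ g′ → f ⊕ g ≈ f′ ⊕ g′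
_⟨⊕⟩_ = ⊕-cong

_⟨⊗⟩_ : ∀ {f f′ g g′} → f ≈ f′ → g ≈ g′ → f ⊗ g ≈ f′ ⊗ g′
_⟨⊗⟩_ = ⊗-cong

X-suc : ∀ {n f} → X n ≈ f → X (suc n) ≈ X 1 ⊗ f
X-suc {n} p = ≈-trans (X-+ 1 n) (≈-refl ⟨⊗⟩ p)

X-add : ∀ {m n f g} → X m ≈ f → X n ≈ g → X (m + n) ≈ f ⊗ g
X-add {m} {n} p q = ≈-trans (X-+ m n) (p ⟨⊗⟩ q)

D-mono : ∀ {n f} → X n ≈ f → D n ≈ 𝟙 ⊕ f
D-mono p = ≈-refl ⟨⊕⟩ p

∸-offset : ∀ {n} m e → n ≡ m + e → n ∸ m ≡ e
∸-offset m e refl = ℕ.m+n∸m≡n m e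

weight-suc : ∀ t → X (suc t * suc (suc t)) ≈ X (t * suc t) ⊗ X (2 + (t + t))
weight-suc t = X-split (t * suc t) (2 + (t + t)) (eq t)
  where
  eq : ∀ t → suc t * suc (suc t) ≡ t * suc t + (2 + (t + t))
  eq = solve-∀

-- Here r = 2t + 2 equals n + 1: the column has just entered row n + 1, while `term n t` and
-- `telescope n (suc t)` are still zero.
row-term-boundary : ∀ n t → n ≡ suc (t + t) →
  D (suc n) ⊗ D (suc (n + n)) ⊗ term (suc n) t ⊕ X n ⊗ term n t ≈ telescope n t ⊕ telescope n (suc t)
row-term-boundary n t p = begin
  D (suc n) ⊗ D (suc (n + n)) ⊗ term (suc n) t ⊕ X n ⊗ term n t
    ≈⟨ dn ⟨⊗⟩ ≈-refl ⟨⊗⟩ (≈-refl ⟨⊗⟩ ≈-refl ⟨⊗⟩ I≡ i₀ ⟨⊗⟩ ≈-refl)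
       ⟨⊕⟩ ≈-refl ⟨⊗⟩ (≈-refl ⟨⊗⟩ I≡ i₁ ⟨⊗⟩ ≈-refl) ⟩
  D m ⊗ D (suc (n + n)) ⊗ (w ⊗ D m ⊗ 𝟙 ⊗ B) ⊕ X n ⊗ (w ⊗ D m ⊗ 𝟘 ⊗ P (n + m))
    ≈⟨ solve 8 (λ d d′ w b x w′ b′ b″ →
         d :* d′ :* (w :* d :* con true :* b) :+ x :* (w :* d :* con false :* b′)
         := w :* con true :* (d′ :* ((d :* d) :* b)) :+ w′ :* con false :* b″) ≈-refl
         (D m) (D (suc (n + n))) w B (X n) w′ (P (n + m)) (P (suc n + (suc t + suc t))) ⟩
  w ⊗ 𝟙 ⊗ (D (suc (n + n)) ⊗ ((D m ⊗ D m) ⊗ B)) ⊕ w′ ⊗ 𝟘 ⊗ P (suc n + (suc t + suc t))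
    ≈⟨ ≈-refl ⟨⊗⟩ I≡ i₀ ⟨⊗⟩ p₁ ⟨⊕⟩ ≈-refl ⟨⊗⟩ I≡ i₂ ⟨⊗⟩ ≈-refl ⟨
  telescope n t ⊕ telescope n (suc t) ∎
  where
  m = 2 + (t + t)
  w = X (t * suc t)
  w′ = X (suc t * suc (suc t))
  B = P (suc n + m)
  dn : D (suc n) ≈ D m
  dn = ≈-reflexive (cong (D ∘ suc) p)
  i₀ : n ∸ (t + t) ≡ 1
  i₀ = ∸-offset (t + t) 1 (trans p (ℕ.+-comm 1 (t + t)))
  i₁ : n ∸ suc (t + t) ≡ 0
  i₁ = ∸-offset (suc (t + t)) 0 (trans p (sym (ℕ.+-identityʳ _)))
  i₂ : n ∸ (suc t + suc t) ≡ 0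
  i₂ = ℕ.m≤n⇒m∸n≡0 (ℕ.≤-trans (ℕ.≤-reflexive p) (s≤s (ℕ.+-monoʳ-≤ t (ℕ.n≤1+n t))))
  eq₁ : ∀ n t → n + (2 + (t + t)) ≡ suc (suc n + (t + t))
  eq₁ = solve-∀
  -- Since n = 2t + 1, the left side is 1/(q)_{2n}; the factor 1 - q^(2n+2) splits as `D m ⊗ D m`.
  p₁ : P (suc n + (t + t)) ≈ D (suc (n + n)) ⊗ ((D m ⊗ D m) ⊗ B)
  p₁ = ≈-trans (P-step-at (eq₁ n t))
         (≈-reflexive (cong D (trans (cong (n +_) (cong suc (sym p))) (ℕ.+-suc n n)))
          ⟨⊗⟩ ≈-trans (P-step (n + m))
            (≈-trans (≈-reflexive (cong (λ k → D (suc k + m)) p)) (D-double m) ⟨⊗⟩ ≈-refl))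

-- With c = q^(2t+2) and a = q^e, so that q^n = ca, every inverse product is a polynomial multiple
-- of A or B. The certificate becomes one polynomial identity in q, c and a.
row-term-interior : ∀ n t e → n ≡ suc (t + t) + suc e →
  D (suc n) ⊗ D (suc (n + n)) ⊗ term (suc n) t ⊕ X n ⊗ term n t ≈ telescope n t ⊕ telescope n (suc t)
row-term-interior n t e p = begin
  D (suc n) ⊗ D (suc (n + n)) ⊗ term (suc n) t ⊕ X n ⊗ term n t
    ≈⟨ D-mono (X-suc xn) ⟨⊗⟩ D-mono (X-suc (X-add xn xn)) ⟨⊗⟩ (≈-refl ⟨⊗⟩ ≈-refl ⟨⊗⟩ I≡ i₀ ⟨⊗⟩ ≈-refl)
       ⟨⊕⟩ xn ⟨⊗⟩ (≈-refl ⟨⊗⟩ ≈-refl ⟨⊗⟩ ≈-trans (I≡ i₁) p₀ ⟨⊗⟩ p₁) ⟩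
  (𝟙 ⊕ q ⊗ (c ⊗ a)) ⊗ (𝟙 ⊕ q ⊗ ((c ⊗ a) ⊗ (c ⊗ a))) ⊗ (w ⊗ (𝟙 ⊕ c) ⊗ A ⊗ B)
    ⊕ (c ⊗ a) ⊗ (w ⊗ (𝟙 ⊕ c) ⊗ ((𝟙 ⊕ q ⊗ a) ⊗ A) ⊗ ((𝟙 ⊕ q ⊗ ((c ⊗ a) ⊗ c)) ⊗ B))
    ≈⟨ solve 6 (λ q a c w A B →
        (con true :+ q :* (c :* a)) :* (con true :+ q :* ((c :* a) :* (c :* a))) :* (w :* (con true :+ c) :* A :* B)
        :+ (c :* a) :* (w :* (con true :+ c) :* ((con true :+ q :* a) :* A) :* ((con true :+ q :* ((c :* a) :* c)) :* B))
        := w :* A :* ((con true :+ (c :* a) :* c) :* ((con true :+ q :* ((c :* a) :* c)) :* B))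
        :+ (w :* c) :* ((con true :+ a) :* ((con true :+ q :* a) :* A)) :* B)
        ≈-refl q a c w A B ⟩
  w ⊗ A ⊗ ((𝟙 ⊕ (c ⊗ a) ⊗ c) ⊗ ((𝟙 ⊕ q ⊗ ((c ⊗ a) ⊗ c)) ⊗ B))
    ⊕ (w ⊗ c) ⊗ ((𝟙 ⊕ a) ⊗ ((𝟙 ⊕ q ⊗ a) ⊗ A)) ⊗ B
    ≈⟨ ≈-refl ⟨⊗⟩ I≡ i₀ ⟨⊗⟩ p₂
       ⟨⊕⟩ weight-suc t ⟨⊗⟩ ≈-trans (I≡ i₂) (≈-trans (I-step e) (≈-refl ⟨⊗⟩ p₀)) ⟨⊗⟩ P≡ (eq₃ n t) ⟨
  telescope n t ⊕ telescope n (suc t) ∎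
  where
  m = 2 + (t + t)
  w = X (t * suc t)
  c = X m
  q = X 1
  a = X e
  A = P (suc e)
  B = P (suc n + m)
  eq₁ : ∀ t e → suc (t + t) + suc e ≡ 2 + (t + t) + e
  eq₁ = solve-∀
  eq₂ : ∀ n t → n + (2 + (t + t)) ≡ suc (suc n + (t + t))
  eq₂ = solve-∀
  eq₃ : ∀ n t → suc n + (suc t + suc t) ≡ suc n + (2 + (t + t))
  eq₃ = solve-∀
  xn : X n ≈ c ⊗ a
  xn = X-split m e (trans p (eq₁ t e))
  i₀ : n ∸ (t + t) ≡ suc (suc e)
  i₀ = ∸-offset (t + t) (suc (suc e)) (trans p (sym (ℕ.+-suc (t + t) (suc e))))
  i₁ : n ∸ suc (t + t) ≡ suc e
  i₁ = ∸-offset (suc (t + t)) (suc e) p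
  i₂ : n ∸ (suc t + suc t) ≡ e
  i₂ = ∸-offset (suc t + suc t) e (trans p (trans (eq₁ t e) (cong (λ k → suc k + e) (sym (ℕ.+-suc t t)))))
  p₀ : P e ≈ (𝟙 ⊕ q ⊗ a) ⊗ A
  p₀ = ≈-trans (P-step e) (D-mono (X-suc ≈-refl) ⟨⊗⟩ ≈-refl)
  p₁ : P (n + m) ≈ (𝟙 ⊕ q ⊗ ((c ⊗ a) ⊗ c)) ⊗ B
  p₁ = ≈-trans (P-step (n + m)) (D-mono (X-suc (X-add xn ≈-refl)) ⟨⊗⟩ ≈-refl)
  p₂ : P (suc n + (t + t)) ≈ (𝟙 ⊕ (c ⊗ a) ⊗ c) ⊗ ((𝟙 ⊕ q ⊗ ((c ⊗ a) ⊗ c)) ⊗ B)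
  p₂ = ≈-trans (P-step-at (eq₂ n t)) (D-mono (X-add xn ≈-refl) ⟨⊗⟩ p₁)

row-term : ∀ n t →
  D (suc n) ⊗ D (suc (n + n)) ⊗ term (suc n) t ⊕ X n ⊗ term n t ≈ telescope n t ⊕ telescope n (suc t)
row-term n t with offset n (t + t)
... | inj₂ (zero , p)  = row-term-boundary n t (trans p (ℕ.+-identityʳ _))
... | inj₂ (suc e , p) = row-term-interior n t e p
... | inj₁ n≤2t = ≈-trans
  (both-𝟘 _ _ (vanishing-factor _ _ (I-∸≈𝟘 n≤2t))
              (vanishing-factor _ _ (I-∸≈𝟘 (ℕ.m≤n⇒m≤1+n n≤2t))))
  (≈-sym (≈-trans
    (⊕-cong (vanishing-factor _ _ (I-∸≈𝟘 n≤2t))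
            (vanishing-factor _ _ (I-∸≈𝟘 (ℕ.≤-trans n≤2t (ℕ.+-mono-≤ (ℕ.n≤1+n t) (ℕ.n≤1+n t))))))
    (⊕-same 𝟘)))

-- The entry r = 0, where α₀ = 1, leaves exactly the left end of the telescoping sum over t, so the
-- two cancel.
row-corner : ∀ n →
  D (suc n) ⊗ D (suc (n + n)) ⊗ (P (suc n) ⊗ P (suc n)) ⊕ X n ⊗ (P n ⊗ P n) ≈ telescope n 0
row-corner n = begin
  D (suc n) ⊗ D (suc (n + n)) ⊗ (A ⊗ A) ⊕ a ⊗ (P n ⊗ P n)
    ≈⟨ D-mono (X-suc ≈-refl) ⟨⊗⟩ D-mono (X-suc (X-+ n n)) ⟨⊗⟩ ≈-refl ⟨⊕⟩ ≈-refl ⟨⊗⟩ (p ⟨⊗⟩ p) ⟩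
  (𝟙 ⊕ q ⊗ a) ⊗ (𝟙 ⊕ q ⊗ (a ⊗ a)) ⊗ (A ⊗ A) ⊕ a ⊗ (((𝟙 ⊕ q ⊗ a) ⊗ A) ⊗ ((𝟙 ⊕ q ⊗ a) ⊗ A))
    ≈⟨ solve 3 (λ q a A →
         (con true :+ q :* a) :* (con true :+ q :* (a :* a)) :* (A :* A)
         :+ a :* (((con true :+ q :* a) :* A) :* ((con true :+ q :* a) :* A))
         := con true :* ((con true :+ a) :* ((con true :+ q :* a) :* A)) :* A) ≈-refl q a A ⟩
  𝟙 ⊗ (D n ⊗ ((𝟙 ⊕ q ⊗ a) ⊗ A)) ⊗ A
    ≈⟨ X-0 ⟨⊗⟩ ≈-trans (I-step n) (≈-refl ⟨⊗⟩ p) ⟨⊗⟩ P≡ (ℕ.+-identityʳ (suc n)) ⟨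
  telescope n 0 ∎
  where
  a = X n
  q = X 1
  A = P (suc n)
  p : P n ≈ (𝟙 ⊕ q ⊗ a) ⊗ A
  p = ≈-trans (P-step n) (D-mono (X-suc ≈-refl) ⟨⊗⟩ ≈-refl)

row : ℕ → ℕ → Series
row R n = P n ⊗ P n ⊕ ∑ R (term n)

-- The bound makes the right end `telescope n R` vanish: R columns reach r = 2R and so exhaust the
-- even indices in both rows.
row-step : ∀ R n → n ≤ R + R → D (suc n) ⊗ D (suc (n + n)) ⊗ row R (suc n) ≈ X n ⊗ row R n
row-step R n n≤2R = ⊕-≈𝟘⇒≈ (begin
  dd ⊗ row R (suc n) ⊕ X n ⊗ row R n
    ≈⟨ solve 6 (λ d x p s p′ s′ → d :* (p :+ s) :+ x :* (p′ :+ s′)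
                 := (d :* p :+ x :* p′) :+ (d :* s :+ x :* s′)) ≈-refl
         dd (X n) _ (∑ R (term (suc n))) _ (∑ R (term n)) ⟩
  (dd ⊗ (P (suc n) ⊗ P (suc n)) ⊕ X n ⊗ (P n ⊗ P n)) ⊕ (dd ⊗ ∑ R (term (suc n)) ⊕ X n ⊗ ∑ R (term n))
    ≈⟨ row-corner n ⟨⊕⟩ (≈-sym (∑-⊗ R dd _) ⟨⊕⟩ ≈-sym (∑-⊗ R (X n) _)) ⟩
  telescope n 0 ⊕ (∑ R (λ t → dd ⊗ term (suc n) t) ⊕ ∑ R (λ t → X n ⊗ term n t))
    ≈⟨ ≈-refl ⟨⊕⟩ ≈-trans (≈-sym (∑-⊕ R _ _)) (≈-trans (∑-cong R (row-term n)) (∑-telescope R (telescope n))) ⟩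
  telescope n 0 ⊕ (telescope n 0 ⊕ telescope n R)
    ≈⟨ solve 2 (λ a b → a :+ (a :+ b) := b) ≈-refl (telescope n 0) (telescope n R) ⟩
  telescope n R
    ≈⟨ vanishing-factor _ _ (I-∸≈𝟘 n≤2R) ⟩
  𝟘 ∎)
  where
  dd = D (suc n) ⊗ D (suc (n + n))

β : ℕ → Series
β n = X (n C 2) ⊗ Q n ⊗ P (n + n)

C-suc : ∀ n → suc n C 2 ≡ n + n C 2
C-suc n = trans (sym (nCk+nC[k+1]≡[n+1]C[k+1] n 1)) (cong (_+ n C 2) (nC1≡n n))

-- The prefactor `D (suc n)` and the equal new factor of `Q (suc n)` multiply to 1 - q^(2n+2), the
-- factor that separates (q)_{2n+1} from (q)_{2n+2}.
β-step : ∀ n → D (suc n) ⊗ D (suc (n + n)) ⊗ β (suc n) ≈ X n ⊗ β n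
β-step n = begin
  D (suc n) ⊗ D (suc (n + n)) ⊗ (X (suc n C 2) ⊗ (Q n ⊗ D (suc n)) ⊗ P (suc n + suc n))
    ≈⟨ ≈-refl ⟨⊗⟩ (X-split n (n C 2) (C-suc n) ⟨⊗⟩ ≈-refl ⟨⊗⟩ ≈-refl) ⟩
  D (suc n) ⊗ D (suc (n + n)) ⊗ ((X n ⊗ X (n C 2)) ⊗ (Q n ⊗ D (suc n)) ⊗ P (suc n + suc n))
    ≈⟨ solve 6 (λ d d′ x y k p → d :* d′ :* ((x :* y) :* (k :* d) :* p)
                := x :* (y :* k :* (d′ :* ((d :* d) :* p)))) ≈-refl
         (D (suc n)) (D (suc (n + n))) (X n) (X (n C 2)) (Q n) (P (suc n + suc n)) ⟩
  X n ⊗ (X (n C 2) ⊗ Q n ⊗ (D (suc (n + n)) ⊗ ((D (suc n) ⊗ D (suc n)) ⊗ P (suc n + suc n))))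
    ≈⟨ ≈-refl ⟨⊗⟩ (≈-refl ⟨⊗⟩ ≈-trans (P-step (n + n)) (≈-refl ⟨⊗⟩
         ≈-trans (P-step-at (cong suc (ℕ.+-suc n n))) (D-double (suc n) ⟨⊗⟩ ≈-refl))) ⟨
  X n ⊗ β n ∎

term-0 : ∀ t → term 0 t ≈ 𝟘
term-0 t = vanishing-factor _ _ ≈-refl

β≈row : ∀ R n → n ≤ suc (R + R) → β n ≈ row R n
β≈row R zero    _ = begin
  X 0 ⊗ 𝟙 ⊗ 𝟙         ≈⟨ X-0 ⟨⊗⟩ ≈-refl ⟨⊗⟩ ≈-refl ⟩
  𝟙 ⊗ 𝟙 ⊗ 𝟙
    ≈⟨ solve 0 (con true :* con true :* con true := con true :* con true :+ con false) ≈-refl ⟩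
  𝟙 ⊗ 𝟙 ⊕ 𝟘           ≈⟨ ≈-refl ⟨⊕⟩ ∑-𝟘 R term-0 ⟨
  row R 0             ∎
β≈row R (suc n) (s≤s n≤2R) = D-cancel n (D-cancel (n + n) (begin
  D (suc (n + n)) ⊗ (D (suc n) ⊗ β (suc n))       ≈⟨ rearrange (β (suc n)) ⟩
  D (suc n) ⊗ D (suc (n + n)) ⊗ β (suc n)         ≈⟨ β-step n ⟩
  X n ⊗ β n                                       ≈⟨ ≈-refl ⟨⊗⟩ β≈row R n (ℕ.m≤n⇒m≤1+n n≤2R) ⟩
  X n ⊗ row R n                                   ≈⟨ row-step R n n≤2R ⟨
  D (suc n) ⊗ D (suc (n + n)) ⊗ row R (suc n)     ≈⟨ rearrange (row R (suc n)) ⟨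
  D (suc (n + n)) ⊗ (D (suc n) ⊗ row R (suc n))   ∎))
  where
  rearrange : ∀ f → D (suc (n + n)) ⊗ (D (suc n) ⊗ f) ≈ D (suc n) ⊗ D (suc (n + n)) ⊗ f
  rearrange = solve 3 (λ d d′ f → d′ :* (d :* f) := d :* d′ :* f) ≈-refl (D (suc n)) (D (suc (n + n)))

-- Summation by columns

-- With r = 2t + 2, the partial sum Σ_{n ≤ N} qⁿ (q)_{n-1}² / ((q)_{n-r} (q)_{n+r}) telescopes to
-- q^r / (1 - q^r)² times the cofactor, since (1 - qⁿ)² - (1 - q^{n-r}) (1 - q^{n+r}) = q^{n-r} (1 - q^r)².
cofactor column : ℕ → ℕ → Series
cofactor N t = Q N ⊗ Q N ⊗ I (N ∸ suc (t + t)) ⊗ P (N + (2 + (t + t)))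
column N t = X (suc t * suc (suc t)) ⊗ G (2 + (t + t)) ⊗ cofactor N t

-- The weight α_r brings one factor 1 - q^r, so only a single `G` is left of 1/(1 - q^r)². The
-- difference of cofactors yields (1 - q^r)²; one factor cancels this `G` and the other is the `D`
-- inside `term`.
column-step : ∀ N t →
  column (suc N) t ⊕ column N t ≈ X (suc N) ⊗ (Q N ⊗ Q N) ⊗ term (suc N) t
column-step N t with offset N (t + t)
... | inj₁ N≤2t = ≈-trans
        (≈-trans (⊕-cong (zero-column (suc N) (s≤s N≤2t)) (zero-column N (ℕ.m≤n⇒m≤1+n N≤2t))) (⊕-same 𝟘))
        (≈-sym (≈-trans (≈-refl ⟨⊗⟩ vanishing-factor _ _ (I-∸≈𝟘 N≤2t)) (⊗-zeroʳ _)))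
  where
  zero-column : ∀ N → N ≤ suc (t + t) → column N t ≈ 𝟘
  zero-column N N≤1+2t = ≈-trans (≈-refl ⟨⊗⟩ vanishing-factor _ _ (I-∸≈𝟘 N≤1+2t)) (⊗-zeroʳ _)
... | inj₂ (e , p) = begin
  column (suc N) t ⊕ column N t
    ≈⟨ w′ ⟨⊗⟩ ≈-refl ⟨⊗⟩ ((≈-refl ⟨⊗⟩ dn) ⟨⊗⟩ (≈-refl ⟨⊗⟩ dn) ⟨⊗⟩ I≡ i₀ ⟨⊗⟩ ≈-refl)
       ⟨⊕⟩ w′ ⟨⊗⟩ ≈-refl ⟨⊗⟩ (≈-refl ⟨⊗⟩ ≈-trans (I≡ i₁) (I-step e) ⟨⊗⟩ p₁) ⟩
  (w ⊗ c) ⊗ g ⊗ ((Q N ⊗ (𝟙 ⊕ c ⊗ a)) ⊗ (Q N ⊗ (𝟙 ⊕ c ⊗ a)) ⊗ A ⊗ B)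
    ⊕ (w ⊗ c) ⊗ g ⊗ (Q N ⊗ Q N ⊗ ((𝟙 ⊕ a) ⊗ A) ⊗ ((𝟙 ⊕ (c ⊗ a) ⊗ c) ⊗ B))
    ≈⟨ solve 7 (λ w c g k a A B →
         (w :* c) :* g :* ((k :* (con true :+ c :* a)) :* (k :* (con true :+ c :* a)) :* A :* B)
         :+ (w :* c) :* g :* (k :* k :* ((con true :+ a) :* A) :* ((con true :+ (c :* a) :* c) :* B))
         := ((con true :+ c) :* g) :* ((c :* a) :* (k :* k) :* (w :* (con true :+ c) :* A :* B)))
         ≈-refl w c g (Q N) a A B ⟩
  (D m ⊗ g) ⊗ ((c ⊗ a) ⊗ (Q N ⊗ Q N) ⊗ (w ⊗ D m ⊗ A ⊗ B))
    ≈⟨ ≈-trans (D-G (suc (t + t)) ⟨⊗⟩ ≈-refl) (solve 1 (λ f → con true :* f := f) ≈-refl _) ⟩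
  (c ⊗ a) ⊗ (Q N ⊗ Q N) ⊗ (w ⊗ D m ⊗ A ⊗ B)
    ≈⟨ xn ⟨⊗⟩ ≈-refl ⟨⊗⟩ (≈-refl ⟨⊗⟩ I≡ i₀ ⟨⊗⟩ ≈-refl) ⟨
  X (suc N) ⊗ (Q N ⊗ Q N) ⊗ term (suc N) t ∎
  where
  m = 2 + (t + t)
  g = G m
  w = X (t * suc t)
  c = X m
  a = X e
  A = P e
  B = P (suc N + m)
  w′ = weight-suc t
  xn : X (suc N) ≈ c ⊗ a
  xn = X-split m e (cong suc p)
  dn = D-mono xn
  i₀ : N ∸ (t + t) ≡ suc e
  i₀ = ∸-offset (t + t) (suc e) (trans p (sym (ℕ.+-suc (t + t) e)))
  i₁ : N ∸ suc (t + t) ≡ e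
  i₁ = ∸-offset (suc (t + t)) e p
  p₁ : P (N + m) ≈ (𝟙 ⊕ (c ⊗ a) ⊗ c) ⊗ B
  p₁ = ≈-trans (P-step (N + m)) (D-mono (X-add xn ≈-refl) ⟨⊗⟩ ≈-refl)

-- Both are indexed by the smallest part minus one.
summand lambert : ℕ → Series
summand n = X (suc n) ⊗ (Q n ⊗ Q n) ⊗ β (suc n)
lambert n = X (suc n) ⊗ G (2 + (n + n))

G-double : ∀ n → G (suc n) ⊗ G (suc n) ≈ G (2 + (n + n))
G-double n = D-cancel (suc (n + n)) (begin
  D (2 + (n + n)) ⊗ (g ⊗ g)
    ≈⟨ ≈-trans (≈-reflexive (cong (D ∘ suc) (sym (ℕ.+-suc n n)))) (D-double (suc n)) ⟨⊗⟩ ≈-refl ⟩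
  (D (suc n) ⊗ D (suc n)) ⊗ (g ⊗ g)
    ≈⟨ solve 2 (λ d g → (d :* d) :* (g :* g) := (d :* g) :* (d :* g)) ≈-refl (D (suc n)) g ⟩
  (D (suc n) ⊗ g) ⊗ (D (suc n) ⊗ g)           ≈⟨ D-G n ⟨⊗⟩ D-G n ⟩
  𝟙 ⊗ 𝟙                                       ≈⟨ solve 0 (con true :* con true := con true) ≈-refl ⟩
  𝟙                                           ≈⟨ D-G (suc (n + n)) ⟨
  D (2 + (n + n)) ⊗ G (2 + (n + n))           ∎)
  where g = G (suc n)

-- The contribution of r = 0: with p = n + 1 it is q^p (q)_{p-1}² / (q)_p² = q^p / (1 - q^p)².
lambert≈ : ∀ n → X (suc n) ⊗ (Q n ⊗ Q n) ⊗ (P (suc n) ⊗ P (suc n)) ≈ lambert n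
lambert≈ n = begin
  X (suc n) ⊗ (Q n ⊗ Q n) ⊗ ((P n ⊗ g) ⊗ (P n ⊗ g))
    ≈⟨ solve 4 (λ x k p g → x :* (k :* k) :* ((p :* g) :* (p :* g))
                := x :* ((k :* p) :* (k :* p) :* (g :* g))) ≈-refl (X (suc n)) (Q n) (P n) g ⟩
  X (suc n) ⊗ ((Q n ⊗ P n) ⊗ (Q n ⊗ P n) ⊗ (g ⊗ g))
    ≈⟨ ≈-refl ⟨⊗⟩ (Q-P n ⟨⊗⟩ Q-P n ⟨⊗⟩ G-double n) ⟩
  X (suc n) ⊗ (𝟙 ⊗ 𝟙 ⊗ G (2 + (n + n)))
    ≈⟨ ≈-refl ⟨⊗⟩ solve 1 (λ g → con true :* con true :* g := g) ≈-refl _ ⟩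
  lambert n ∎
  where g = G (suc n)

summand≈ : ∀ R N → N ≤ R + R →
  summand N ≈ lambert N ⊕ (∑ R (column (suc N)) ⊕ ∑ R (column N))
summand≈ R N N≤2R = begin
  a ⊗ β (suc N)                                            ≈⟨ ≈-refl ⟨⊗⟩ β≈row R (suc N) (s≤s N≤2R) ⟩
  a ⊗ (P (suc N) ⊗ P (suc N) ⊕ ∑ R (term (suc N)))
    ≈⟨ solve 3 (λ a p s → a :* (p :+ s) := a :* p :+ a :* s) ≈-refl a _ (∑ R (term (suc N))) ⟩
  a ⊗ (P (suc N) ⊗ P (suc N)) ⊕ a ⊗ ∑ R (term (suc N))     ≈⟨ lambert≈ N ⟨⊕⟩ ≈-sym (∑-⊗ R a _) ⟩
  lambert N ⊕ ∑ R (λ t → a ⊗ term (suc N) t)               ≈⟨ ≈-refl ⟨⊕⟩ ∑-cong R (column-step N) ⟨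
  lambert N ⊕ ∑ R (λ t → column (suc N) t ⊕ column N t)    ≈⟨ ≈-refl ⟨⊕⟩ ∑-⊕ R _ _ ⟩
  lambert N ⊕ (∑ R (column (suc N)) ⊕ ∑ R (column N))      ∎
  where a = X (suc N) ⊗ (Q N ⊗ Q N)

-- Consecutive columns cancel and `column 0` is zero, so only the last column survives. The bound
-- ensures that every row in use is complete.
summand-sum : ∀ R N → N ≤ R + R → ∑ N summand ≈ ∑ N lambert ⊕ ∑ R (column N)
summand-sum R zero    _ = begin
  𝟘                    ≈⟨ ⊕-same 𝟘 ⟨
  𝟘 ⊕ 𝟘
    ≈⟨ ≈-refl ⟨⊕⟩ ∑-𝟘 R (λ t → ≈-trans (≈-refl ⟨⊗⟩ vanishing-factor _ _ ≈-refl) (⊗-zeroʳ _)) ⟨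
  𝟘 ⊕ ∑ R (column 0)   ∎
summand-sum R (suc N) N<2R = begin
  ∑ N summand ⊕ summand N
    ≈⟨ summand-sum R N N≤2R ⟨⊕⟩ summand≈ R N N≤2R ⟩
  (∑ N lambert ⊕ ∑ R (column N)) ⊕ (lambert N ⊕ (∑ R (column (suc N)) ⊕ ∑ R (column N)))
    ≈⟨ solve 4 (λ s c l c′ → (s :+ c) :+ (l :+ (c′ :+ c)) := (s :+ l) :+ c′) ≈-refl
         (∑ N lambert) (∑ R (column N)) (lambert N) (∑ R (column (suc N))) ⟩
  (∑ N lambert ⊕ lambert N) ⊕ ∑ R (column (suc N)) ∎
  where N≤2R = ℕ.<⇒≤ N<2R

-- Low-order coefficients and parity of exponents

Low : ℕ → Series → Set
Low N f = ∀ n → n < N → f n ≡ false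

-- Vanishing of the even part modulo q^N. Such series form a module over the series in q².
OddBelow : ℕ → Series → Set
OddBelow N f = ∀ j → j + j < N → f (j + j) ≡ false

⊗′-low-at : ∀ f g n → (∀ i → i ≤ n → f i ≡ false) → (f ⊗′ g) n ≡ false
⊗′-low-at f g zero    z rewrite z 0 z≤n = refl
⊗′-low-at f g (suc n) z rewrite z 0 z≤n = ⊗′-low-at (f ∘ suc) g n (λ i i≤n → z (suc i) (s≤s i≤n))

opaque
  unfolding _⊗_

  ⊕-at : ∀ f g n → (f ⊕ g) n ≡ f n xor g n
  ⊕-at f g n = refl

  Low-⊗ : ∀ {N f} g → Low N f → Low N (f ⊗ g)
  Low-⊗ {N} {f} g z n n<N = ⊗′-low-at f g n (λ i i≤n → z i (ℕ.≤-<-trans i≤n n<N))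

opaque
  unfolding X

  X-odd-even : ∀ k j → X (suc (k + k)) (j + j) ≡ false
  X-odd-even k       zero    = refl
  X-odd-even zero    (suc j) rewrite ℕ.+-suc j j = refl
  X-odd-even (suc k) (suc j) rewrite ℕ.+-suc j j | ℕ.+-suc k k = X-odd-even k j

X-⊗-at : ∀ k f n → (X k ⊗ f) (k + n) ≡ f n
X-⊗-at zero    f n = coefficient (X-0-⊗ f) n
X-⊗-at (suc k) f n = trans (coefficient (X-suc-⊗ k f) (suc (k + n))) (X-⊗-at k f n)

Low-X : ∀ k {N f} → Low N f → Low (k + N) (X k ⊗ f)
Low-X zero    {f = f} z n       n<N       = trans (coefficient (X-0-⊗ f) n) (z n n<N)
Low-X (suc k) {f = f} z zero    _         = coefficient (X-suc-⊗ k f) 0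
Low-X (suc k) {f = f} z (suc n) (s≤s n<N) = trans (coefficient (X-suc-⊗ k f) (suc n)) (Low-X k z n n<N)

Low-≤ : ∀ {M N f} → M ≤ N → Low N f → Low M f
Low-≤ M≤N z n n<M = z n (ℕ.<-≤-trans n<M M≤N)

Low-X-⊗ : ∀ {N} k f → N ≤ k → Low N (X k ⊗ f)
Low-X-⊗ k f N≤k = Low-≤ (ℕ.≤-trans N≤k (ℕ.m≤m+n k 0)) (Low-X k {0} {f} (λ _ ()))

Low-≈ : ∀ {N f g} → f ≈ g → Low N g → Low N f
Low-≈ p z n n<N = trans (coefficient p n) (z n n<N)

Low-𝟘 : ∀ {N} → Low N 𝟘
Low-𝟘 n _ = 𝟘-at n

Low-⊕ : ∀ {N f g} → Low N f → Low N g → Low N (f ⊕ g)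
Low-⊕ {f = f} {g} y z n n<N = trans (⊕-at f g n) (cong₂ _xor_ (y n n<N) (z n n<N))

Low-∑ : ∀ {N} R {f : ℕ → Series} → (∀ t → Low N (f t)) → Low N (∑ R f)
Low-∑ zero    z = Low-𝟘
Low-∑ (suc R) z = Low-⊕ (Low-∑ R z) (z R)

Low⇒OddBelow : ∀ {N f} → Low N f → OddBelow N f
Low⇒OddBelow z j = z (j + j)

OddBelow-≈ : ∀ {N f g} → f ≈ g → OddBelow N g → OddBelow N f
OddBelow-≈ p z j j<N = trans (coefficient p (j + j)) (z j j<N)

OddBelow-⊕ : ∀ {N f g} → OddBelow N f → OddBelow N g → OddBelow N (f ⊕ g)
OddBelow-⊕ {f = f} {g} y z j j<N = trans (⊕-at f g (j + j)) (cong₂ _xor_ (y j j<N) (z j j<N))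

OddBelow-∑ : ∀ {N} R {f : ℕ → Series} → (∀ t → OddBelow N (f t)) → OddBelow N (∑ R f)
OddBelow-∑ zero    z = Low⇒OddBelow Low-𝟘
OddBelow-∑ (suc R) z = OddBelow-⊕ (OddBelow-∑ R z) (z R)

-- In f = (1 - q^m) f + q^m f with m = 2k + 2, an even coefficient of f depends only on the product
-- and on an earlier even coefficient of f. Hence strong induction on half the exponent.
OddBelow-cancel : ∀ {N} k f → OddBelow N (D (2 + (k + k)) ⊗ f) → OddBelow N f
OddBelow-cancel {N} k f z = <-rec _ λ j rec j<N → go j rec j<N (offset j k)
  where
  m = 2 + (k + k)
  f≈ : f ≈ D m ⊗ f ⊕ X m ⊗ f
  f≈ = solve 2 (λ x f → f := (con true :+ x) :* f :+ x :* f) ≈-refl (X m) f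
  unfold : ∀ n → f n ≡ (D m ⊗ f) n xor (X m ⊗ f) n
  unfold n = trans (coefficient f≈ n) (⊕-at _ _ n)
  eq : ∀ k i → (suc k + i) + (suc k + i) ≡ 2 + (k + k) + (i + i)
  eq = solve-∀
  go : ∀ j → (∀ {i} → i < j → i + i < N → f (i + i) ≡ false) → j + j < N →
       (j ≤ k ⊎ ∃ λ i → j ≡ suc k + i) → f (j + j) ≡ false
  go j rec j<N (inj₁ j≤k) = trans (unfold (j + j))
    (cong₂ _xor_ (z j j<N) (Low-X-⊗ m f ℕ.≤-refl (j + j) (s≤s (ℕ.m≤n⇒m≤1+n (ℕ.+-mono-≤ j≤k j≤k)))))
  go j rec j<N (inj₂ (i , refl)) = trans (unfold (j + j))
    (cong₂ _xor_ (z j j<N)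
      (trans (cong (X m ⊗ f) (eq k i))
        (trans (X-⊗-at m f (i + i))
          (rec i<j (ℕ.≤-<-trans (ℕ.+-mono-≤ (ℕ.<⇒≤ i<j) (ℕ.<⇒≤ i<j)) j<N)))))
    where
    i<j : i < suc k + i
    i<j = s≤s (ℕ.m≤n+m i k)

-- The quotient is the product of 1 - q^i over e < i ≤ e + j.
Q-P-low : ∀ e j → Low (suc e) (Q (j + e) ⊗ P e ⊕ 𝟙)
Q-P-low e zero    = Low-≈ (≈-trans (Q-P e ⟨⊕⟩ ≈-refl) (⊕-same 𝟙)) Low-𝟘
Q-P-low e (suc j) = Low-≈
  (solve 3 (λ k x p → k :* (con true :+ x) :* p :+ con true := (k :* p :+ con true) :+ x :* (k :* p))
     ≈-refl (Q (j + e)) (X (suc j + e)) (P e))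
  (Low-⊕ (Q-P-low e j) (Low-X-⊗ (suc j + e) _ (s≤s (ℕ.m≤n+m e j))))

Q-P-low′ : ∀ n j → Low (suc n) (Q n ⊗ P (j + n) ⊕ 𝟙)
Q-P-low′ n zero    = Q-P-low n 0
Q-P-low′ n (suc j) = Low-≈
  (≈-trans
    (solve 3 (λ k x p → k :* p :+ con true := (k :* ((con true :+ x) :* p) :+ con true) :+ x :* (k :* p))
       ≈-refl (Q n) (X (suc j + n)) (P (suc j + n)))
    ((≈-refl ⟨⊗⟩ ≈-sym (P-step (j + n)) ⟨⊕⟩ ≈-refl) ⟨⊕⟩ ≈-refl))
  (Low-⊕ (Q-P-low′ n j) (Low-X-⊗ (suc j + n) _ (s≤s (ℕ.m≤n+m n j))))

-- With r = 2t + 2 and N = r + e, the quotient (q)_N / (q)_{N-r} is 1 up to order e + 1, and (q)_N /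
-- (q)_{N+r} up to the higher order N + 1.
cofactor-low : ∀ t e → Low (suc e) (cofactor (2 + (t + t) + e) t ⊕ 𝟙)
cofactor-low t e = Low-≈
  (≈-trans
    ((≈-refl ⟨⊗⟩ I≡ (∸-offset (suc (t + t)) (suc e) (cong suc (sym (ℕ.+-suc (t + t) e)))) ⟨⊗⟩ P≡ (ℕ.+-comm N m)) ⟨⊕⟩ ≈-refl)
    (solve 3 (λ k p p′ → k :* k :* p :* p′ :+ con true := (k :* p :+ con true) :* (k :* p′) :+ (k :* p′ :+ con true))
      ≈-refl (Q N) (P e) (P (m + N))))
  (Low-⊕ (Low-⊗ _ (Q-P-low e m)) (Low-≤ (s≤s (ℕ.m≤n+m e m)) (Q-P-low′ N m)))
  where
  m = 2 + (t + t)
  N = m + e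

2+2t≤ : ∀ t → 2 + (t + t) ≤ suc t * suc (suc t)
2+2t≤ t = ℕ.≤-trans (ℕ.m≤m+n (2 + (t + t)) (t + t * t)) (ℕ.≤-reflexive (eq t))
  where
  eq : ∀ t → 2 + (t + t) + (t + t * t) ≡ suc t * suc (suc t)
  eq = solve-∀

-- The limit of a column: q^(n²+n) / (1 - q^(2n)) for n = t + 1.
lambert² : ℕ → Series
lambert² t = X (suc t * suc (suc t)) ⊗ G (2 + (t + t))

-- The cofactor alone has an error of order N - r + 1, where r = 2t + 2. The monomial in front has
-- degree (t+1)(t+2) ≥ r and lifts it to N + 1; when N < r the monomial suffices by itself.
column-low : ∀ N t → Low (suc N) (column N t ⊕ lambert² t)
column-low N t = Low-≈
  (solve 3 (λ x g k → x :* g :* k :+ x :* g := x :* ((k :+ con true) :* g)) ≈-refl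
    (X (suc t * suc (suc t))) (G (2 + (t + t))) (cofactor N t))
  (low (offset N (suc (t + t))))
  where
  low : (N ≤ suc (t + t) ⊎ ∃ λ e → N ≡ 2 + (t + t) + e) →
        Low (suc N) (X (suc t * suc (suc t)) ⊗ ((cofactor N t ⊕ 𝟙) ⊗ G (2 + (t + t))))
  low (inj₁ N≤) = Low-X-⊗ _ _ (ℕ.≤-trans (s≤s N≤) (2+2t≤ t))
  low (inj₂ (e , refl)) = Low-≤
    (ℕ.≤-trans (ℕ.≤-reflexive (sym (ℕ.+-suc (2 + (t + t)) e))) (ℕ.+-monoˡ-≤ (suc e) (2+2t≤ t)))
    (Low-X (suc t * suc (suc t)) (Low-⊗ _ (cofactor-low t e)))

∑-double : ∀ A f → ∑ (A + A) f ≈ ∑ A (λ k → f (k + k) ⊕ f (suc (k + k)))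
∑-double zero    f = ≈-refl
∑-double (suc A) f = begin
  ∑ (A + suc A) f ⊕ f (A + suc A)           ≈⟨ ≈-reflexive (cong (λ n → ∑ n f ⊕ f n) (ℕ.+-suc A A)) ⟩
  (∑ (A + A) f ⊕ f (A + A)) ⊕ f (suc (A + A))
    ≈⟨ solve 3 (λ s a b → (s :+ a) :+ b := s :+ (a :+ b)) ≈-refl (∑ (A + A) f) _ _ ⟩
  ∑ (A + A) f ⊕ (f (A + A) ⊕ f (suc (A + A)))
    ≈⟨ ∑-double A f ⟨⊕⟩ ≈-refl ⟩
  ∑ (suc A) (λ k → f (k + k) ⊕ f (suc (k + k))) ∎

-- The Lambert series

odd : ℕ → ℕ
odd k = suc (k + k)

oddG : ℕ → Series
oddG k = G (2 + ((k + k) + (k + k)))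

geometric : ∀ t b → D (2 + (t + t)) ⊗ ∑ b (λ j → X (suc t * odd j)) ≈ X (suc t) ⊕ X (suc t * odd b)
geometric t zero    = begin
  D (2 + (t + t)) ⊗ 𝟘               ≈⟨ ⊗-zeroʳ _ ⟩
  𝟘                                 ≈⟨ ⊕-same _ ⟨
  X (suc t) ⊕ X (suc t)             ≈⟨ ≈-refl ⟨⊕⟩ ≈-reflexive (cong X (sym (ℕ.*-identityʳ (suc t)))) ⟩
  X (suc t) ⊕ X (suc t * 1)         ∎
geometric t (suc b) = begin
  D m ⊗ (∑ b (λ j → X (suc t * odd j)) ⊕ x)
    ≈⟨ solve 3 (λ c s x → (con true :+ c) :* (s :+ x) := (con true :+ c) :* s :+ (x :+ c :* x)) ≈-refl (X m) _ x ⟩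
  D m ⊗ ∑ b (λ j → X (suc t * odd j)) ⊕ (x ⊕ X m ⊗ x)
    ≈⟨ geometric t b ⟨⊕⟩ (≈-refl ⟨⊕⟩ ≈-sym (X-split m (suc t * odd b) (eq t b))) ⟩
  (X (suc t) ⊕ x) ⊕ (x ⊕ X (suc t * odd (suc b)))
    ≈⟨ solve 3 (λ a x y → (a :+ x) :+ (x :+ y) := a :+ y) ≈-refl _ x _ ⟩
  X (suc t) ⊕ X (suc t * odd (suc b)) ∎
  where
  m = 2 + (t + t)
  x = X (suc t * odd b)
  eq : ∀ t b → suc t * suc (suc b + suc b) ≡ 2 + (t + t) + suc t * suc (b + b)
  eq = solve-∀

-- For n = 2k + 2 both series are progressions with difference 2n, starting at n and at n(n + 1). As
-- n + 1 is odd, the second is a tail of the first, and what remains is n times each odd number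
-- below n.
even-pair : ∀ k → lambert (odd k) ⊕ lambert² (odd k) ≈ ∑ (suc k) (λ j → X (odd j * (2 + (k + k))))
even-pair k = begin
  X (suc t) ⊗ g ⊕ X (suc t * suc (suc t)) ⊗ g
    ≈⟨ solve 3 (λ x y g → x :* g :+ y :* g := g :* (x :+ y)) ≈-refl (X (suc t)) (X (suc t * suc (suc t))) g ⟩
  g ⊗ (X (suc t) ⊕ X (suc t * suc (suc t)))
    ≈⟨ ≈-refl ⟨⊗⟩ (≈-refl ⟨⊕⟩ ≈-reflexive (cong (λ n → X (suc t * suc (suc n))) (sym (ℕ.+-suc k k)))) ⟩
  g ⊗ (X (suc t) ⊕ X (suc t * odd (suc k)))
    ≈⟨ ≈-refl ⟨⊗⟩ geometric t (suc k) ⟨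
  g ⊗ (D (2 + (t + t)) ⊗ s)
    ≈⟨ solve 3 (λ g d s → g :* (d :* s) := (d :* g) :* s) ≈-refl g (D (2 + (t + t))) s ⟩
  (D (2 + (t + t)) ⊗ g) ⊗ s
    ≈⟨ ≈-trans (D-G (suc (t + t)) ⟨⊗⟩ ≈-refl) (solve 1 (λ f → con true :* f := f) ≈-refl s) ⟩
  s
    ≈⟨ ∑-cong (suc k) (λ j → ≈-reflexive (cong X (ℕ.*-comm (suc t) (odd j)))) ⟩
  ∑ (suc k) (λ j → X (odd j * (2 + (k + k)))) ∎
  where
  t = odd k
  g = G (2 + (t + t))
  s = ∑ (suc k) (λ j → X (suc t * odd j))

-- The right-hand side is what the truncation at even factors ≤ 2A leaves over.
lambert-even : ∀ A →
  ∑ A (λ k → lambert² (k + k) ⊕ (lambert (odd k) ⊕ lambert² (odd k)))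
  ≈ ∑ A (λ k → X (odd k * (2 + (A + A))) ⊗ oddG k)
lambert-even zero    = ≈-refl
lambert-even (suc A) = begin
  ∑ A _ ⊕ (lambert² (A + A) ⊕ (lambert (odd A) ⊕ lambert² (odd A)))
    ≈⟨ lambert-even A ⟨⊕⟩ (≈-refl ⟨⊕⟩ even-pair A) ⟩
  -- `lambert² (A + A)` is `u A` by definition: the odd factor 2A + 1 enters with even cofactors
  -- from 2A + 2 on. The block v then removes the cofactor 2A + 2 for every odd factor up to 2A + 1.
  ∑ A u ⊕ (u A ⊕ ∑ (suc A) v)
    ≈⟨ solve 3 (λ a b c → a :+ (b :+ c) := (a :+ b) :+ c) ≈-refl (∑ A u) (u A) (∑ (suc A) v) ⟩
  ∑ (suc A) u ⊕ ∑ (suc A) v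
    ≈⟨ ∑-⊕ (suc A) u v ⟨
  ∑ (suc A) (λ k → u k ⊕ v k)
    ≈⟨ ∑-cong (suc A) merge ⟩
  ∑ (suc A) (λ k → X (odd k * (2 + (suc A + suc A))) ⊗ oddG k) ∎
  where
  u v : ℕ → Series
  u k = X (odd k * (2 + (A + A))) ⊗ oddG k
  v k = X (odd k * (2 + (A + A)))
  eq : ∀ k A → suc (k + k) * (2 + (suc A + suc A)) ≡ suc (k + k) * (2 + (A + A)) + (2 + ((k + k) + (k + k)))
  eq = solve-∀
  merge : ∀ k → u k ⊕ v k ≈ X (odd k * (2 + (suc A + suc A))) ⊗ oddG k
  merge k = begin
    v k ⊗ oddG k ⊕ v k
      ≈⟨ solve 2 (λ x g → x :* g :+ x := x :* g :+ x :* con true) ≈-refl (v k) (oddG k) ⟩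
    v k ⊗ oddG k ⊕ v k ⊗ 𝟙
      ≈⟨ ≈-refl ⟨⊕⟩ ≈-refl ⟨⊗⟩ D-G (suc ((k + k) + (k + k))) ⟨
    v k ⊗ oddG k ⊕ v k ⊗ ((𝟙 ⊕ X (2 + ((k + k) + (k + k)))) ⊗ oddG k)
      ≈⟨ solve 3 (λ x g c → x :* g :+ x :* ((con true :+ c) :* g) := (x :* c) :* g) ≈-refl (v k) (oddG k) _ ⟩
    (v k ⊗ X (2 + ((k + k) + (k + k)))) ⊗ oddG k
      ≈⟨ X-split (odd k * (2 + (A + A))) _ (eq k A) ⟨⊗⟩ ≈-refl ⟨
    X (odd k * (2 + (suc A + suc A))) ⊗ oddG k ∎

-- For odd n the exponents in q^n / (1 - q^(2n)) are odd multiples of n.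
lambert-odd : ∀ {N} k → OddBelow N (lambert (k + k))
lambert-odd k = OddBelow-cancel (k + k) _ (OddBelow-≈ (begin
  D m ⊗ (X (odd k) ⊗ G m)
    ≈⟨ solve 3 (λ d x g → d :* (x :* g) := (d :* g) :* x) ≈-refl (D m) (X (odd k)) (G m) ⟩
  (D m ⊗ G m) ⊗ X (odd k)     ≈⟨ D-G (suc ((k + k) + (k + k))) ⟨⊗⟩ ≈-refl ⟩
  𝟙 ⊗ X (odd k)               ≈⟨ solve 1 (λ f → con true :* f := f) ≈-refl _ ⟩
  X (odd k)                   ∎)
  (λ j _ → X-odd-even k j))
  where m = 2 + ((k + k) + (k + k))

lambert-OddBelow : ∀ A → OddBelow (suc (A + A)) (∑ (A + A) (λ t → lambert t ⊕ lambert² t))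
lambert-OddBelow A = OddBelow-≈
  (begin
    ∑ (A + A) (λ t → lambert t ⊕ lambert² t)
      ≈⟨ ∑-double A _ ⟩
    ∑ A (λ k → (lambert (k + k) ⊕ lambert² (k + k)) ⊕ (lambert (odd k) ⊕ lambert² (odd k)))
      ≈⟨ ∑-cong A (λ k → solve 3 (λ a b c → (a :+ b) :+ c := a :+ (b :+ c)) ≈-refl (lambert (k + k)) (lambert² (k + k)) _) ⟩
    ∑ A (λ k → lambert (k + k) ⊕ (lambert² (k + k) ⊕ (lambert (odd k) ⊕ lambert² (odd k))))
      ≈⟨ ≈-trans (∑-⊕ A _ _) (≈-refl ⟨⊕⟩ lambert-even A) ⟩
    ∑ A (λ k → lambert (k + k)) ⊕ ∑ A (λ k → X (odd k * (2 + (A + A))) ⊗ oddG k) ∎)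
  (OddBelow-⊕ (OddBelow-∑ A lambert-odd)
    (Low⇒OddBelow (Low-∑ A λ k → Low-X-⊗ (odd k * (2 + (A + A))) _
      (ℕ.≤-trans (ℕ.n≤1+n _) (ℕ.m≤n*m (2 + (A + A)) (odd k))))))

summand-OddBelow : ∀ A → OddBelow (suc (A + A)) (∑ (A + A) summand)
summand-OddBelow A = OddBelow-≈
  (begin
    ∑ N summand
      ≈⟨ summand-sum N N (ℕ.m≤m+n N N) ⟩
    ∑ N lambert ⊕ ∑ N (column N)
      ≈⟨ solve 3 (λ l c l′ → l :+ c := (l :+ l′) :+ (c :+ l′)) ≈-refl (∑ N lambert) (∑ N (column N)) (∑ N lambert²) ⟩
    (∑ N lambert ⊕ ∑ N lambert²) ⊕ (∑ N (column N) ⊕ ∑ N lambert²)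
      ≈⟨ ∑-⊕ N _ _ ⟨⊕⟩ ∑-⊕ N _ _ ⟨
    ∑ N (λ t → lambert t ⊕ lambert² t) ⊕ ∑ N (λ t → column N t ⊕ lambert² t) ∎)
  (OddBelow-⊕ (lambert-OddBelow A) (Low⇒OddBelow (Low-∑ N (column-low N))))
  where N = A + A

-- Parity of the number of partitions

isOdd : ℕ → Bool
isOdd zero    = false
isOdd (suc n) = not (isOdd n)

isOdd-+ : ∀ m n → isOdd (m + n) ≡ isOdd m xor isOdd n
isOdd-+ zero    n = refl
isOdd-+ (suc m) n = trans (cong not (isOdd-+ m n)) (not-distribˡ-xor (isOdd m) (isOdd n))

¬isOdd⇒2∣ : ∀ n → isOdd n ≡ false → 2 ∣ n
¬isOdd⇒2∣ zero          _ = 2 ∣0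
¬isOdd⇒2∣ (suc (suc n)) p = ∣m∣n⇒∣m+n ∣-refl (¬isOdd⇒2∣ n (trans (sym (not-involutive _)) p))

xorSum : ∀ {A : Set} → (A → Bool) → List A → Bool
xorSum w []       = false
xorSum w (x ∷ xs) = w x xor xorSum w xs

xorSum-++ : ∀ {A : Set} (w : A → Bool) xs ys → xorSum w (xs ++ ys) ≡ xorSum w xs xor xorSum w ys
xorSum-++ w []       ys = refl
xorSum-++ w (x ∷ xs) ys = trans (cong (w x xor_) (xorSum-++ w xs ys)) (sym (xor-assoc (w x) _ _))

xorSum-map : ∀ {A B : Set} (w : B → Bool) (f : A → B) xs → xorSum w (map f xs) ≡ xorSum (w ∘ f) xs
xorSum-map w f []       = refl
xorSum-map w f (x ∷ xs) = cong (w (f x) xor_) (xorSum-map w f xs)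

xorSum-concatMap : ∀ {A B : Set} (w : B → Bool) (f : A → List B) xs →
                   xorSum w (concatMap f xs) ≡ xorSum (λ x → xorSum w (f x)) xs
xorSum-concatMap w f []       = refl
xorSum-concatMap w f (x ∷ xs) =
  trans (xorSum-++ w (f x) _) (cong (xorSum w (f x) xor_) (xorSum-concatMap w f xs))

xorSum-cong : ∀ {A : Set} {v w : A → Bool} → v ≗ w → ∀ xs → xorSum v xs ≡ xorSum w xs
xorSum-cong v≗w []       = refl
xorSum-cong v≗w (x ∷ xs) = cong₂ _xor_ (v≗w x) (xorSum-cong v≗w xs)

xorSum-∧ : ∀ {A : Set} b (w : A → Bool) xs → xorSum (λ x → b ∧ w x) xs ≡ b ∧ xorSum w xs
xorSum-∧ b w []       = sym (∧-zeroʳ b)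
xorSum-∧ b w (x ∷ xs) = trans (cong ((b ∧ w x) xor_) (xorSum-∧ b w xs)) (sym (∧-distribˡ-xor b _ _))

isOdd-sum : ∀ {A : Set} (f : A → ℕ) xs → isOdd (sum (map f xs)) ≡ xorSum (isOdd ∘ f) xs
isOdd-sum f []       = refl
isOdd-sum f (x ∷ xs) = trans (isOdd-+ (f x) _) (cong (isOdd (f x) xor_) (isOdd-sum f xs))

⨁ : ℕ → (ℕ → Bool) → Bool
⨁ zero    f = false
⨁ (suc n) f = f 0 xor ⨁ n (f ∘ suc)

⨁-cong : ∀ n {f g : ℕ → Bool} → f ≗ g → ⨁ n f ≡ ⨁ n g
⨁-cong zero    p = refl
⨁-cong (suc n) p = cong₂ _xor_ (p 0) (⨁-cong n (p ∘ suc))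

⨁-xor : ∀ n f g → ⨁ n (λ i → f i xor g i) ≡ ⨁ n f xor ⨁ n g
⨁-xor zero    f g = refl
⨁-xor (suc n) f g = trans (cong ((f 0 xor g 0) xor_) (⨁-xor n (f ∘ suc) (g ∘ suc)))
                          (xor-interchange (f 0) (g 0) _ _)

⨁-false : ∀ n {f : ℕ → Bool} → (∀ i → f i ≡ false) → ⨁ n f ≡ false
⨁-false zero    p = refl
⨁-false (suc n) p = cong₂ _xor_ (p 0) (⨁-false n (p ∘ suc))

⨁-snoc : ∀ n (f : ℕ → Bool) → ⨁ (suc n) f ≡ ⨁ n f xor f n
⨁-snoc zero    f = xor-comm (f 0) false
⨁-snoc (suc n) f = trans (cong (f 0 xor_) (⨁-snoc n (f ∘ suc))) (sym (xor-assoc (f 0) _ _))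

xorSum-upTo : ∀ n (g : ℕ → ℕ) (w : ℕ → Bool) → xorSum w (applyUpTo g n) ≡ ⨁ n (w ∘ g)
xorSum-upTo zero    g w = refl
xorSum-upTo (suc n) g w = cong (w (g 0) xor_) (xorSum-upTo n (g ∘ suc) w)

∑-at : ∀ R f n → ∑ R f n ≡ ⨁ R (λ t → f t n)
∑-at zero    f n = 𝟘-at n
∑-at (suc R) f n = trans (⊕-at _ _ n)
  (trans (cong (_xor f R n) (∑-at R f n)) (sym (⨁-snoc R (λ t → f t n))))

-- Pairs j ≤ i < m, reindexed by i = j + k.
⨁-triangle : ∀ m (h : ℕ → ℕ → Bool) →
  ⨁ m (λ i → ⨁ (suc i) (h i)) ≡ ⨁ m (λ j → ⨁ (m ∸ j) (λ k → h (j + k) j))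
⨁-triangle zero    h = refl
⨁-triangle (suc m) h =
  trans (cong₂ _xor_ (xor-identityʳ (h 0 0)) (⨁-xor m (λ i → h (suc i) 0) rest))
    (trans (sym (xor-assoc (h 0 0) _ _))
      (cong (⨁ (suc m) (λ k → h k 0) xor_) (⨁-triangle m (λ i j → h (suc i) (suc j)))))
  where
  rest : ℕ → Bool
  rest i = ⨁ (suc i) (λ j → h (suc i) (suc j))

⨁-select : ∀ n m (f : ℕ → Bool) → m < n → ⨁ n (λ k → (k ≡ᵇ m) ∧ f k) ≡ f m
⨁-select (suc n) zero    f _         = trans (cong (f 0 xor_) (⨁-false n (λ _ → refl))) (xor-identityʳ _)
⨁-select (suc n) (suc m) f (s≤s m<n) = ⨁-select n m (f ∘ suc) m<n

-- The test selects k = m - c, as multiplication by q^c does; the bound keeps this index inside the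
-- range of summation.
⨁-X : ∀ c m n (f : Series) → m < c + n → ⨁ n (λ k → (c + k ≡ᵇ m) ∧ f k) ≡ (X c ⊗ f) m
⨁-X zero    m       n f m<n         = trans (⨁-select n m f m<n) (sym (coefficient (X-0-⊗ f) m))
⨁-X (suc c) zero    n f _           = trans (⨁-false n (λ _ → refl)) (sym (coefficient (X-suc-⊗ c f) 0))
⨁-X (suc c) (suc m) n f (s≤s m<c+n) = trans (⨁-X c m n f m<c+n) (sym (coefficient (X-suc-⊗ c f) (suc m)))

-- Partition lists and their recursion on the least allowed part

ptns-fuel : ∀ f g n k → n ≤ f → n ≤ g → ptns f n (suc k) ≡ ptns g n (suc k)
ptns-fuel f       g       zero    k _         _         = refl
ptns-fuel (suc f) (suc g) (suc n) k (s≤s n≤f) (s≤s n≤g) =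
  trans (concatMap-map (F f) (suc k +_) is)
    (trans (concatMap-cong (λ i → cong (map (suc k + i ∷_))
                                    (ptns-fuel f g (n ∸ (k + i)) (k + i) (∸≤ i n≤f) (∸≤ i n≤g))) is)
           (sym (concatMap-map (F g) (suc k +_) is)))
  where
  is = upTo (suc n ∸ k)
  F : ℕ → ℕ → List (List ℕ)
  F h p = map (p ∷_) (ptns h (suc n ∸ p) p)
  ∸≤ : ∀ i {h} → n ≤ h → n ∸ (k + i) ≤ h
  ∸≤ i n≤h = ℕ.≤-trans (ℕ.m∸n≤m n (k + i)) n≤h

ptns-split : ∀ f n l → l ≤ n →
  ptns (suc f) (suc n) (suc l)
  ≡ map (suc l ∷_) (ptns f (n ∸ l) (suc l)) ++ ptns (suc f) (suc n) (2 + l)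
ptns-split f n l l≤n = cong (concatMap (λ p → map (p ∷_) (ptns f (suc n ∸ p) p))) parts
  where
  parts : map (suc l +_) (upTo (suc n ∸ l)) ≡ suc l ∷ map (2 + l +_) (upTo (n ∸ l))
  parts = trans (cong (map (suc l +_) ∘ upTo) (ℕ.+-∸-assoc 1 l≤n))
    (cong₂ _∷_ (ℕ.+-identityʳ (suc l))
      (trans (cong (map (suc l +_)) (sym (map-upTo suc (n ∸ l))))
        (trans (sym (map-∘ (upTo (n ∸ l)))) (map-cong (λ i → ℕ.+-suc (suc l) i) (upTo (n ∸ l))))))

ptns-empty : ∀ f n l → n < l → ptns f (suc n) (suc l) ≡ []
ptns-empty zero    n l _   = refl
ptns-empty (suc f) n l n<l rewrite ℕ.m≤n⇒m∸n≡0 n<l = refl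

partitionSeries : (List ℕ → Bool) → ℕ → Series
partitionSeries w l k = xorSum w (ptns k k l)

partitionSeries-cong : ∀ {v w} l → v ≗ w → partitionSeries v l ≈ partitionSeries w l
partitionSeries-cong l v≗w = coefficients λ k → xorSum-cong v≗w (ptns k k l)

partitionSeries-low : ∀ w l → Low (suc l) (partitionSeries w (suc l) ⊕ const (w []))
partitionSeries-low w l zero    _         =
  trans (⊕-at _ _ 0) (trans (cong (_xor w []) (xor-identityʳ (w []))) (xor-same (w [])))
partitionSeries-low w l (suc n) (s≤s n<l) =
  trans (⊕-at _ _ (suc n)) (trans (xor-identityʳ _) (cong (xorSum w) (ptns-empty (suc n) n l n<l)))

-- Either the least allowed part l + 1 is absent, or one copy stands in front; stripping it costs
-- q^(l+1) and passes its effect to the weight.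
partitionSeries-step : ∀ w l →
  partitionSeries w (suc l)
  ≈ partitionSeries w (2 + l) ⊕ X (suc l) ⊗ partitionSeries (w ∘ (suc l ∷_)) (suc l)
partitionSeries-step w l = coefficients λ k → trans (go k) (sym (⊕-at _ _ k))
  where
  rest = partitionSeries (w ∘ (suc l ∷_)) (suc l)
  go : ∀ k → partitionSeries w (suc l) k ≡ partitionSeries w (2 + l) k xor (X (suc l) ⊗ rest) k
  go zero    = sym (trans (cong (partitionSeries w (2 + l) 0 xor_) (coefficient (X-suc-⊗ l rest) 0)) (xor-identityʳ _))
  go (suc n) with ℕ.≤-<-connex l n
  ... | inj₂ n<l = trans (cong (xorSum w) (ptns-empty (suc n) n l n<l))
    (sym (cong₂ _xor_ (cong (xorSum w) (ptns-empty (suc n) n (suc l) (ℕ.m<n⇒m<1+n n<l)))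
                      (Low-X-⊗ (suc l) rest ℕ.≤-refl (suc n) (s≤s n<l))))
  ... | inj₁ l≤n = trans (cong (xorSum w) (ptns-split n n l l≤n))
    (trans (xorSum-++ w (map (suc l ∷_) (ptns n (n ∸ l) (suc l))) _)
      (trans (xor-comm (xorSum w (map (suc l ∷_) (ptns n (n ∸ l) (suc l)))) _)
        (cong (partitionSeries w (2 + l) (suc n) xor_)
          (trans (xorSum-map w (suc l ∷_) (ptns n (n ∸ l) (suc l)))
            (trans (cong (xorSum (w ∘ (suc l ∷_))) (ptns-fuel n (n ∸ l) (n ∸ l) l (ℕ.m∸n≤m n l) ℕ.≤-refl))
              (trans (sym (X-⊗-at (suc l) rest (n ∸ l)))
                (cong (λ k → (X (suc l) ⊗ rest) (suc k)) (ℕ.m+[n∸m]≡n l≤n))))))))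

-- Admissible tails weighted by the parity of a multiplicity

good : ℕ → ℕ → Bool
good p x = not (odd? x) ∨ (x ≤ᵇ 2 * p)

-- The flag b makes the family of weights closed under removing a part p, which flips b.
weight : ℕ → Bool → List ℕ → Bool
weight p b τ = all (good p) τ ∧ (b xor isOdd (occ p τ))

≤⇒≤ᵇ≡true : ∀ {m n} → m ≤ n → (m ≤ᵇ n) ≡ true
≤⇒≤ᵇ≡true m≤n = Equivalence.to T-≡ (ℕ.≤⇒≤ᵇ m≤n)

good-≤ : ∀ p {x} → x ≤ 2 * p → good p x ≡ true
good-≤ p {x} x≤2p rewrite ≤⇒≤ᵇ≡true x≤2p = ∨-zeroʳ (not (odd? x))

good-self : ∀ p → good p p ≡ true
good-self p = good-≤ p (ℕ.m≤m+n p (p + 0))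

odd?-double : ∀ j → odd? (j + j) ≡ false
odd?-double zero    = refl
odd?-double (suc j) rewrite ℕ.+-suc j j = odd?-double j

odd?-odd : ∀ j → odd? (odd j) ≡ true
odd?-odd zero    = refl
odd?-odd (suc j) rewrite ℕ.+-suc j j = odd?-odd j

good-even : ∀ p j → good p (j + j) ≡ true
good-even p j rewrite odd?-double j = refl

good-odd : ∀ p j → p ≤ j → good p (odd j) ≡ false
good-odd p j p≤j rewrite odd?-odd j = go (odd j ≤ᵇ 2 * p) refl
  where
  2p≤ : 2 * p ≤ j + j
  2p≤ = ℕ.+-mono-≤ p≤j (ℕ.≤-trans (ℕ.≤-reflexive (ℕ.+-identityʳ p)) p≤j)
  go : ∀ b → (odd j ≤ᵇ 2 * p) ≡ b → b ≡ false
  go false _ = refl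
  go true  q = contradiction (ℕ.≤-trans (ℕ.≤ᵇ⇒≤ (odd j) (2 * p) (Equivalence.from T-≡ q)) 2p≤) ℕ.1+n≰n

occ-self : ∀ p τ → occ p (p ∷ τ) ≡ suc (occ p τ)
occ-self p τ = cong length (filter-accept (p ≟_) refl)

occ-other : ∀ {p x} τ → p ≢ x → occ p (x ∷ τ) ≡ occ p τ
occ-other {p} τ p≢x = cong length (filter-reject (p ≟_) p≢x)

weight-self : ∀ p b τ → weight p b (p ∷ τ) ≡ weight p (not b) τ
weight-self p b τ = cong₂ _∧_
  (cong (_∧ all (good p) τ) (good-self p))
  (trans (cong (λ n → b xor isOdd n) (occ-self p τ))
         (trans (sym (not-distribʳ-xor b _)) (not-distribˡ-xor b _)))

weight-other : ∀ p b {x} τ → p ≢ x → weight p b (x ∷ τ) ≡ good p x ∧ weight p b τ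
weight-other p b {x} τ p≢x = trans
  (cong (λ n → all (good p) (x ∷ τ) ∧ (b xor isOdd n)) (occ-other τ p≢x))
  (∧-assoc (good p x) _ _)

U : ℕ → Bool → ℕ → Series
U p b l = partitionSeries (weight p b) l

U-self : ∀ n b → let p = suc n in U p b p ≈ U p b (suc p) ⊕ X p ⊗ U p (not b) p
U-self n b = ≈-trans (partitionSeries-step _ n)
  (≈-refl ⟨⊕⟩ ≈-refl ⟨⊗⟩ partitionSeries-cong (suc n) (weight-self (suc n) b))

U-good : ∀ p b l → p ≢ suc l → good p (suc l) ≡ true → D (suc l) ⊗ U p b (suc l) ≈ U p b (2 + l)
U-good p b l p≢l g = begin
  D (suc l) ⊗ u
    ≈⟨ solve 2 (λ x u → (con true :+ x) :* u := u :+ x :* u) ≈-refl (X (suc l)) u ⟩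
  u ⊕ X (suc l) ⊗ u
    ≈⟨ ≈-trans (partitionSeries-step _ l) (≈-refl ⟨⊕⟩ ≈-refl ⟨⊗⟩ partitionSeries-cong (suc l) other) ⟨⊕⟩ ≈-refl ⟩
  (U p b (2 + l) ⊕ X (suc l) ⊗ u) ⊕ X (suc l) ⊗ u
                                      ≈⟨ solve 2 (λ v y → (v :+ y) :+ y := v) ≈-refl (U p b (2 + l)) (X (suc l) ⊗ u) ⟩
  U p b (2 + l)                       ∎
  where
  u = U p b (suc l)
  other : ∀ τ → weight p b (suc l ∷ τ) ≡ weight p b τ
  other τ = trans (weight-other p b τ p≢l) (cong (_∧ weight p b τ) g)

U-bad : ∀ p b l → p ≢ suc l → good p (suc l) ≡ false → U p b (suc l) ≈ U p b (2 + l)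
U-bad p b l p≢l g = ≈-trans (partitionSeries-step _ l)
  (≈-trans (≈-refl ⟨⊕⟩ ≈-trans (≈-refl ⟨⊗⟩ none) (⊗-zeroʳ _)) (⊕-identityʳ _))
  where
  xorSum-false : ∀ (xs : List (List ℕ)) → xorSum (λ _ → false) xs ≡ false
  xorSum-false []       = refl
  xorSum-false (_ ∷ xs) = xorSum-false xs
  none : partitionSeries (weight p b ∘ (suc l ∷_)) (suc l) ≈ 𝟘
  none = coefficients λ k → trans
    (xorSum-cong (λ τ → trans (weight-other p b τ p≢l) (cong (_∧ weight p b τ) g)) (ptns k k (suc l)))
    (trans (xorSum-false (ptns k k (suc l))) (sym (𝟘-at k)))

≤⇒≢suc : ∀ {p l} → p ≤ l → p ≢ suc l
≤⇒≢suc p≤l refl = ℕ.1+n≰n p≤l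

-- Up to 2p every part is allowed whatever its parity, so each removes one ordinary factor 1 - q^l.
U-middle : ∀ p b i → i ≤ p → Q (i + p) ⊗ U p b (suc p) ≈ Q p ⊗ U p b (suc (i + p))
U-middle p b zero    _   = ≈-refl
U-middle p b (suc i) i<p = begin
  (Q (i + p) ⊗ d) ⊗ U p b (suc p)
    ≈⟨ solve 3 (λ k d u → (k :* d) :* u := d :* (k :* u)) ≈-refl (Q (i + p)) d (U p b (suc p)) ⟩
  d ⊗ (Q (i + p) ⊗ U p b (suc p))      ≈⟨ ≈-refl ⟨⊗⟩ U-middle p b i (ℕ.<⇒≤ i<p) ⟩
  d ⊗ (Q p ⊗ U p b (suc (i + p)))
    ≈⟨ solve 3 (λ k d u → d :* (k :* u) := k :* (d :* u)) ≈-refl (Q p) d (U p b (suc (i + p))) ⟩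
  Q p ⊗ (d ⊗ U p b (suc (i + p)))      ≈⟨ ≈-refl ⟨⊗⟩ U-good p b (i + p) (≤⇒≢suc (ℕ.m≤n+m p i))
                                            (good-≤ p (ℕ.+-mono-≤ i<p (ℕ.≤-reflexive (sym (ℕ.+-identityʳ p))))) ⟩
  Q p ⊗ U p b (suc (suc i + p))        ∎
  where d = D (suc (i + p))

D-square : ∀ j → D (suc j) ⊗ D (suc j) ≈ D (2 + (j + j))
D-square j = ≈-trans (≈-sym (D-double (suc j))) (≈-reflexive (cong (D ∘ suc) (ℕ.+-suc j j)))

-- Beyond 2p only even parts are allowed. From each pair 2j + 1, 2j + 2 the odd one drops out and
-- the even one gives 1 - q^(2j+2) = (1 - q^(j+1))², whence the squares of `Q`.
U-large : ∀ p b i → (Q (i + p) ⊗ Q (i + p)) ⊗ U p b (odd p) ≈ (Q p ⊗ Q p) ⊗ U p b (odd (i + p))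
U-large p b zero    = ≈-refl
U-large p b (suc i) = begin
  ((Q j ⊗ d) ⊗ (Q j ⊗ d)) ⊗ U p b (odd p)
    ≈⟨ solve 3 (λ k d u → ((k :* d) :* (k :* d)) :* u := (d :* d) :* ((k :* k) :* u)) ≈-refl (Q j) d (U p b (odd p)) ⟩
  (d ⊗ d) ⊗ ((Q j ⊗ Q j) ⊗ U p b (odd p))
    ≈⟨ D-square j ⟨⊗⟩ U-large p b i ⟩
  D (2 + (j + j)) ⊗ ((Q p ⊗ Q p) ⊗ U p b (odd j))
    ≈⟨ ≈-refl ⟨⊗⟩ (≈-refl ⟨⊗⟩ U-bad p b (j + j) (≤⇒≢suc p≤2j) (good-odd p j p≤j)) ⟩
  D (2 + (j + j)) ⊗ ((Q p ⊗ Q p) ⊗ U p b (2 + (j + j)))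
    ≈⟨ solve 3 (λ k d u → d :* (k :* u) := k :* (d :* u)) ≈-refl (Q p ⊗ Q p) (D (2 + (j + j))) (U p b (2 + (j + j))) ⟩
  (Q p ⊗ Q p) ⊗ (D (2 + (j + j)) ⊗ U p b (2 + (j + j)))
    ≈⟨ ≈-refl ⟨⊗⟩ U-good p b (suc (j + j)) (≤⇒≢suc (ℕ.m≤n⇒m≤1+n p≤2j))
         (trans (cong (good p ∘ suc) (sym (ℕ.+-suc j j))) (good-even p (suc j))) ⟩
  (Q p ⊗ Q p) ⊗ U p b (3 + (j + j))
    ≈⟨ ≈-refl ⟨⊗⟩ ≈-reflexive (cong (U p b ∘ suc ∘ suc) (sym (ℕ.+-suc j j))) ⟩
  (Q p ⊗ Q p) ⊗ U p b (odd (suc j)) ∎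
  where
  j = i + p
  d = D (suc j)
  p≤j : p ≤ j
  p≤j = ℕ.m≤n+m p i
  p≤2j : p ≤ j + j
  p≤2j = ℕ.≤-trans p≤j (ℕ.m≤m+n j j)

U-product : ∀ p b i → Q (p + p) ⊗ (Q (i + p) ⊗ Q (i + p)) ⊗ U p b (suc p)
                    ≈ Q p ⊗ (Q p ⊗ Q p) ⊗ U p b (odd (i + p))
U-product p b i = begin
  Q (p + p) ⊗ e ⊗ U p b (suc p)
    ≈⟨ solve 3 (λ k e u → k :* e :* u := e :* (k :* u)) ≈-refl (Q (p + p)) e (U p b (suc p)) ⟩
  e ⊗ (Q (p + p) ⊗ U p b (suc p))
    ≈⟨ ≈-refl ⟨⊗⟩ U-middle p b p ℕ.≤-refl ⟩
  e ⊗ (Q p ⊗ U p b (odd p))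
    ≈⟨ solve 3 (λ k e u → e :* (k :* u) := k :* (e :* u)) ≈-refl (Q p) e (U p b (odd p)) ⟩
  Q p ⊗ (e ⊗ U p b (odd p))
    ≈⟨ ≈-refl ⟨⊗⟩ U-large p b i ⟩
  Q p ⊗ ((Q p ⊗ Q p) ⊗ U p b (odd (i + p)))
    ≈⟨ solve 3 (λ a b c → a :* (b :* c) := a :* b :* c) ≈-refl (Q p) (Q p ⊗ Q p) (U p b (odd (i + p))) ⟩
  Q p ⊗ (Q p ⊗ Q p) ⊗ U p b (odd (i + p)) ∎
  where e = Q (i + p) ⊗ Q (i + p)

-- One copy of the smallest part p = n + 1 and the staircase δ_p are split off into the monomial;
-- the flag `true` counts that copy in the parity of the multiplicity.
spt : ℕ → Series
spt n = X (suc n + suc n C 2) ⊗ U (suc n) true (suc n)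

U-tail : ℕ → ℕ → Series
U-tail p L = U p true L ⊕ X p ⊗ U p false L

-- Two parts p at a time: removing one smallest part p swaps the flags true and false.
U-smallest : ∀ n → let p = suc n in D (p + p) ⊗ U p true p ≈ U-tail p (suc p)
U-smallest n = begin
  D (p + p) ⊗ u true
    ≈⟨ D-mono (X-+ p p) ⟨⊗⟩ ≈-refl ⟩
  (𝟙 ⊕ X p ⊗ X p) ⊗ u true
    ≈⟨ solve 2 (λ x u → (con true :+ x :* x) :* u := u :+ x :* (x :* u)) ≈-refl (X p) (u true) ⟩
  u true ⊕ X p ⊗ (X p ⊗ u true)
    ≈⟨ U-self n true ⟨⊕⟩ ≈-refl ⟩
  (v true ⊕ X p ⊗ u false) ⊕ X p ⊗ (X p ⊗ u true)
    ≈⟨ (≈-refl ⟨⊕⟩ ≈-refl ⟨⊗⟩ U-self n false) ⟨⊕⟩ ≈-refl ⟩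
  (v true ⊕ X p ⊗ (v false ⊕ X p ⊗ u true)) ⊕ X p ⊗ (X p ⊗ u true)
    ≈⟨ solve 4 (λ v x v′ u → (v :+ x :* (v′ :+ x :* u)) :+ x :* (x :* u) := v :+ x :* v′) ≈-refl
         (v true) (X p) (v false) (u true) ⟩
  U-tail p (suc p) ∎
  where
  p = suc n
  u v : Bool → Series
  u b = U p b p
  v b = U p b (suc p)

-- The finite form of multiplying by (q²;q²)_∞. Both sides are compared after multiplication by
-- `D (p + p)`, which absorbs the copies of p and equals the (1 - q^p)² by which `Q p ⊗ Q p` exceeds
-- `Q n ⊗ Q n`.
U-smallest-product : ∀ n i → let p = suc n ; M = i + p in
  (Q M ⊗ Q M) ⊗ U p true p ≈ (Q n ⊗ Q n) ⊗ (Q p ⊗ P (p + p)) ⊗ U-tail p (odd M)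
U-smallest-product n i = D-cancel (n + p) (begin
  D (p + p) ⊗ (e ⊗ U p true p)
    ≈⟨ solve 3 (λ d e u → d :* (e :* u) := con true :* e :* (d :* u)) ≈-refl (D (p + p)) e (U p true p) ⟩
  𝟙 ⊗ e ⊗ (D (p + p) ⊗ U p true p)
    -- The unit is expanded to supply the factor `Q (p + p)` that clears the parts from p + 1 to 2p.
    ≈⟨ ≈-sym (Q-P (p + p)) ⟨⊗⟩ ≈-refl ⟨⊗⟩ U-smallest n ⟩
  (Q (p + p) ⊗ P (p + p)) ⊗ e ⊗ (v true ⊕ X p ⊗ v false)
    ≈⟨ solve 6 (λ k r e v x v′ → (k :* r) :* e :* (v :+ x :* v′) := r :* (k :* e :* v :+ x :* (k :* e :* v′))) ≈-refl
         (Q (p + p)) (P (p + p)) e (v true) (X p) (v false) ⟩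
  P (p + p) ⊗ (Q (p + p) ⊗ e ⊗ v true ⊕ X p ⊗ (Q (p + p) ⊗ e ⊗ v false))
    ≈⟨ ≈-refl ⟨⊗⟩ (U-product p true i ⟨⊕⟩ ≈-refl ⟨⊗⟩ U-product p false i) ⟩
  P (p + p) ⊗ (Q p ⊗ (Q p ⊗ Q p) ⊗ w true ⊕ X p ⊗ (Q p ⊗ (Q p ⊗ Q p) ⊗ w false))
    ≈⟨ solve 6 (λ r k d w x w′ →
         let k′ = k :* d in
         r :* (k′ :* (k′ :* k′) :* w :+ x :* (k′ :* (k′ :* k′) :* w′))
         := (d :* d) :* ((k :* k) :* (k′ :* r) :* (w :+ x :* w′))) ≈-refl
         (P (p + p)) (Q n) (D p) (w true) (X p) (w false) ⟩
  (D p ⊗ D p) ⊗ ((Q n ⊗ Q n) ⊗ (Q p ⊗ P (p + p)) ⊗ U-tail p (odd (i + p)))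
    ≈⟨ D-double p ⟨⊗⟩ ≈-refl ⟨
  D (p + p) ⊗ ((Q n ⊗ Q n) ⊗ (Q p ⊗ P (p + p)) ⊗ U-tail p (odd (i + p))) ∎)
  where
  p = suc n
  e = Q (i + p) ⊗ Q (i + p)
  v w : Bool → Series
  v b = U p b (suc p)
  w b = U p b (odd (i + p))

-- At these orders only the empty partition counts, with weight 1 under the flag `true` and 0 under
-- `false`.
U-tail-low : ∀ p M → Low (odd M) (U-tail p (odd M) ⊕ 𝟙)
U-tail-low p M = Low-≈
  (solve 3 (λ a x b → (a :+ x :* b) :+ con true := (a :+ con true) :+ (b :+ con false) :* x) ≈-refl
    (U p true (odd M)) (X p) (U p false (odd M)))
  (Low-⊕ (partitionSeries-low (weight p true) (M + M))
         (Low-⊗ (X p) (partitionSeries-low (weight p false) (M + M))))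

spt-low : ∀ n i → let M = i + suc n in Low (odd M) ((Q M ⊗ Q M) ⊗ spt n ⊕ summand n)
spt-low n i = Low-≈ (begin
  e ⊗ (X (p + p C 2) ⊗ U p true p) ⊕ summand n
    ≈⟨ solve 3 (λ e x u → e :* (x :* u) := x :* (e :* u)) ≈-refl e (X (p + p C 2)) (U p true p) ⟨⊕⟩ ≈-refl ⟩
  X (p + p C 2) ⊗ (e ⊗ U p true p) ⊕ summand n
    ≈⟨ X-+ p (p C 2) ⟨⊗⟩ U-smallest-product n i ⟨⊕⟩ ≈-refl ⟩
  (X p ⊗ X (p C 2)) ⊗ ((Q n ⊗ Q n) ⊗ (Q p ⊗ P (p + p)) ⊗ U-tail p (odd (i + p))) ⊕ summand n
    ≈⟨ solve 6 (λ x y k k′ r u →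
         (x :* y) :* ((k :* k) :* (k′ :* r) :* u) :+ x :* (k :* k) :* (y :* k′ :* r)
         := (u :+ con true) :* (x :* (k :* k) :* (y :* k′ :* r))) ≈-refl
         (X p) (X (p C 2)) (Q n) (Q p) (P (p + p)) (U-tail p (odd (i + p))) ⟩
  (U-tail p (odd (i + p)) ⊕ 𝟙) ⊗ summand n ∎)
  (Low-⊗ (summand n) (U-tail-low p (i + p)))
  where
  p = suc n
  e = Q (i + p) ⊗ Q (i + p)

spt-sum-low : ∀ R M → R ≤ M → Low (odd M) ((Q M ⊗ Q M) ⊗ ∑ R spt ⊕ ∑ R summand)
spt-sum-low zero    M _   = Low-≈ (solve 1 (λ e → e :* con false :+ con false := con false) ≈-refl _) Low-𝟘
spt-sum-low (suc R) M R<M = Low-≈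
  (solve 5 (λ e s u s′ u′ → e :* (s :+ u) :+ (s′ :+ u′) := (e :* s :+ s′) :+ (e :* u :+ u′)) ≈-refl
    (Q M ⊗ Q M) (∑ R spt) (spt R) (∑ R summand) (summand R))
  (Low-⊕ (spt-sum-low R M (ℕ.<⇒≤ R<M))
    (subst (λ M → Low (odd M) ((Q M ⊗ Q M) ⊗ spt R ⊕ summand R)) (ℕ.m∸n+n≡m R<M) (spt-low R (M ∸ suc R))))

-- `Q k ⊗ Q k` is (q²;q²)_k in characteristic 2, so it is removed one even factor at a time.
OddBelow-cancel-Q : ∀ {N} k f → OddBelow N ((Q k ⊗ Q k) ⊗ f) → OddBelow N f
OddBelow-cancel-Q zero    f z = OddBelow-≈ (solve 1 (λ f → f := (con true :* con true) :* f) ≈-refl f) z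
OddBelow-cancel-Q (suc k) f z = OddBelow-cancel-Q k f (OddBelow-cancel k _ (OddBelow-≈ (begin
  D (2 + (k + k)) ⊗ ((Q k ⊗ Q k) ⊗ f)          ≈⟨ D-square k ⟨⊗⟩ ≈-refl ⟨
  (d ⊗ d) ⊗ ((Q k ⊗ Q k) ⊗ f)
    ≈⟨ solve 3 (λ d k f → (d :* d) :* ((k :* k) :* f) := ((k :* d) :* (k :* d)) :* f) ≈-refl d (Q k) f ⟩
  ((Q k ⊗ d) ⊗ (Q k ⊗ d)) ⊗ f                  ∎) z))
  where d = D (suc k)

spt-OddBelow : ∀ A → OddBelow (suc (A + A)) (∑ (A + A) spt)
spt-OddBelow A = OddBelow-cancel-Q M _ (OddBelow-≈
  (solve 2 (λ s u → s := u :+ (s :+ u)) ≈-refl _ (∑ M summand))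
  (OddBelow-⊕ (summand-OddBelow A)
    (Low⇒OddBelow (Low-≤ (s≤s (ℕ.m≤m+n M M)) (spt-sum-low M M ℕ.≤-refl)))))
  where M = A + A

-- From the list definition to the generating functions

isOdd-if : ∀ b n → isOdd (if b then n else 0) ≡ b ∧ isOdd n
isOdd-if true  n = refl
isOdd-if false n = refl

-- The head p always passes the admissibility test and adds one to the multiplicity, so stripping it
-- turns the flag `false` into `true`.
contrib-weight : ∀ m N p τ → isOdd (contrib m N (p ∷ τ)) ≡ (N + p C 2 ≡ᵇ m) ∧ weight p true τ
contrib-weight m N p τ = begin≡
  isOdd (if a ∧ e then occ p (p ∷ τ) else 0)                    ≡⟨ isOdd-if (a ∧ e) _ ⟩
  (a ∧ e) ∧ isOdd (occ p (p ∷ τ))                               ≡⟨ cong (_∧ isOdd (occ p (p ∷ τ))) (∧-comm a e) ⟩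
  (e ∧ a) ∧ isOdd (occ p (p ∷ τ))                               ≡⟨ ∧-assoc e a _ ⟩
  e ∧ (a ∧ isOdd (occ p (p ∷ τ)))                               ≡⟨ cong (e ∧_) (weight-self p false τ) ⟩
  e ∧ weight p true τ                                           ∎≡
  where
  open ≡-Reasoning using (step-≡-⟩; step-≡-⟨) renaming (begin_ to begin≡_; _∎ to _∎≡)
  a = admissible (p ∷ τ)
  e = N + p C 2 ≡ᵇ m

-- Exchanging the sums over size and smallest part leaves one generating function for each smallest
-- part; partitions of size at most m have smallest part at most m.
spto⁻-parity : ∀ m → isOdd (spto⁻ m) ≡ ∑ m spt m
spto⁻-parity m = begin≡
  isOdd (spto⁻ m)
    ≡⟨ isOdd-sum (λ i → sum (map (contrib m (suc i)) (partitions (suc i)))) (upTo m) ⟩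
  xorSum (λ i → isOdd (sum (map (contrib m (suc i)) (partitions (suc i))))) (upTo m)
    ≡⟨ xorSum-upTo m id _ ⟩
  ⨁ m (λ i → isOdd (sum (map (contrib m (suc i)) (partitions (suc i)))))
    ≡⟨ ⨁-cong m size ⟩
  ⨁ m (λ i → ⨁ (suc i) (h i))
    ≡⟨ ⨁-triangle m h ⟩
  ⨁ m (λ j → ⨁ (m ∸ j) (λ k → h (j + k) j))
    ≡⟨ ⨁-cong m smallest-part ⟩
  ⨁ m (λ j → spt j m)
    ≡⟨ ∑-at m spt m ⟨
  ∑ m spt m ∎≡
  where
  open ≡-Reasoning using (step-≡-⟩; step-≡-⟨) renaming (begin_ to begin≡_; _∎ to _∎≡)
  u : ℕ → Series
  u j = U (suc j) true (suc j)
  -- Size i + 1 and smallest part j + 1, which leaves i - j for the other parts.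
  h : ℕ → ℕ → Bool
  h i j = (suc i + suc j C 2 ≡ᵇ m) ∧ u j (i ∸ j)
  part : ∀ i j → xorSum (isOdd ∘ contrib m (suc i)) (map (suc j ∷_) (ptns i (i ∸ j) (suc j))) ≡ h i j
  part i j = begin≡
    xorSum (isOdd ∘ contrib m (suc i)) (map (suc j ∷_) τs)
      ≡⟨ xorSum-map _ (suc j ∷_) τs ⟩
    xorSum (λ τ → isOdd (contrib m (suc i) (suc j ∷ τ))) τs
      ≡⟨ xorSum-cong (contrib-weight m (suc i) (suc j)) τs ⟩
    xorSum (λ τ → (suc i + suc j C 2 ≡ᵇ m) ∧ weight (suc j) true τ) τs
      ≡⟨ xorSum-∧ _ (weight (suc j) true) τs ⟩
    (suc i + suc j C 2 ≡ᵇ m) ∧ xorSum (weight (suc j) true) τs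
      ≡⟨ cong (λ τs → (suc i + suc j C 2 ≡ᵇ m) ∧ xorSum (weight (suc j) true) τs)
           (ptns-fuel i (i ∸ j) (i ∸ j) j (ℕ.m∸n≤m i j) ℕ.≤-refl) ⟩
    h i j ∎≡
    where τs = ptns i (i ∸ j) (suc j)
  size : ∀ i → isOdd (sum (map (contrib m (suc i)) (partitions (suc i)))) ≡ ⨁ (suc i) (h i)
  size i = begin≡
    isOdd (sum (map (contrib m (suc i)) (partitions (suc i))))
      ≡⟨ isOdd-sum (contrib m (suc i)) (partitions (suc i)) ⟩
    xorSum w (concatMap F (map suc (upTo (suc i))))
      ≡⟨ xorSum-concatMap w F (map suc (upTo (suc i))) ⟩
    xorSum (xorSum w ∘ F) (map suc (upTo (suc i)))
      ≡⟨ xorSum-map (xorSum w ∘ F) suc (upTo (suc i)) ⟩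
    xorSum (xorSum w ∘ F ∘ suc) (upTo (suc i))
      ≡⟨ xorSum-upTo (suc i) id (xorSum w ∘ F ∘ suc) ⟩
    ⨁ (suc i) (xorSum w ∘ F ∘ suc)
      ≡⟨ ⨁-cong (suc i) (part i) ⟩
    ⨁ (suc i) (h i) ∎≡
    where
    w : List ℕ → Bool
    w = isOdd ∘ contrib m (suc i)
    F : ℕ → List (List ℕ)
    F p = map (p ∷_) (ptns i (suc i ∸ p) p)
  eq : ∀ j k c → suc (j + k) + c ≡ suc j + c + k
  eq = solve-∀
  smallest-part : ∀ j → ⨁ (m ∸ j) (λ k → h (j + k) j) ≡ spt j m
  smallest-part j = trans
    (⨁-cong (m ∸ j) (λ k → cong₂ (λ a b → (a ≡ᵇ m) ∧ u j b) (eq j k (suc j C 2)) (ℕ.m+n∸m≡n j k)))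
    (⨁-X (suc j + suc j C 2) m (m ∸ j) (u j)
      (s≤s (ℕ.≤-trans (ℕ.m≤n+m∸n m j) (ℕ.+-monoˡ-≤ (m ∸ j) (ℕ.m≤m+n j (suc j C 2))))))

theorem4 : (n : ℕ) → 1 ≤ n → 2 ∣ spto⁻ (2 * n)
theorem4 n _ = ¬isOdd⇒2∣ (spto⁻ (2 * n)) (trans (spto⁻-parity (2 * n))
  (subst (λ m → ∑ m spt m ≡ false) (cong (n +_) (sym (ℕ.+-identityʳ n))) (spt-OddBelow n n ℕ.≤-refl)))
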